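{- Define polynomials $\Lambda_k$ in $\lambda$ by $\Lambda_1=\lambda$, $\Lambda_2=\lambda^2-\frac14$, and $\Lambda_k=\lambda\Lambda_{k-1}-\frac14\Lambda_{k-2}$ for every $k\ge 3$. Then for every integer $n\ge 5$, the Randić characteristic polynomial of the path graph $P_n$ on $n$ vertices satisfies $$RP(P_n,\lambda)=(\lambda^2-1)\left(\lambda\Lambda_{n-3}-\tfrac14\Lambda_{n-4}\right).$$
   Context: All graphs are finite and simple. For a graph $G$ with vertices $v_1,\dots,v_n$ of degrees $d_1,\dots,d_n$, the Randić matrix $R(G)$ is the $n\times n$ real symmetric matrix with $(i,j)$-entry $\frac{1}{\sqrt{d_id_j}}$ if $v_i$ and $v_j$ are adjacent, and $0$ otherwise. The Randić characteristic polynomial of $G$ is $RP(G,\lambda)=\det(\lambda I-R(G))$. -}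

module Defs where

open import Algebra.Bundles.Raw using (RawRing)
import Algebra.Definitions.RawSemiring as RawSemiringDefinitions
open import Data.Bool.Base using (if_then_else_)
open import Data.Fin.Base using (Fin; toℕ; punchIn) renaming (zero to fzero; suc to fsuc)
import Data.Fin.Properties as Fin
open import Data.Integer.Base using (+_; +[1+_])
import Data.Integer.Base as ℤ
import Data.Integer.Properties as ℤₚ
open import Data.List.Base using (List; []; _∷_; [_]; map)
open import Data.Nat.Base as ℕ using (ℕ; zero; suc; s≤s)
import Data.Nat.Properties as ℕₚ
open import Data.Nat.Solver using () renaming (module +-*-Solver to ℕ-Solver)
open import Data.Product.Base using (∃; _×_; _,_; proj₁; proj₂)
open import Data.Rational.Base as ℚ using (ℚ; mkℚ; 0ℚ; 1ℚ; ½)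
import Data.Rational.Properties as ℚₚ
open import Data.Rational.Solver using () renaming (module +-*-Solver to ℚ-Solver)
import Data.Rational.Unnormalised.Base as ℚᵘ
import Data.Rational.Unnormalised.Properties as ℚᵘₚ
open import Data.Sum.Base using (_⊎_; inj₁; inj₂; swap)
open import Data.Vec.Base using (Vec; _∷_; count; allFin)
open import Data.Vec.Membership.Propositional using (_∈_)
open import Data.Vec.Membership.Propositional.Properties using (∈-allFin⁺)
open import Data.Vec.Relation.Unary.Any using (here; there)
open import Level using (Level; 0ℓ)
open import Relation.Binary.Core using (Rel)
open import Relation.Binary.Definitions using (Symmetric; Irreflexive; Decidable)
open import Relation.Binary.PropositionalEquality using (_≡_; refl; sym; trans; cong; cong₂; subst; module ≡-Reasoning)
open import Relation.Nullary using (yes; no; does; contradiction)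
open import Relation.Nullary.Decidable using (_⊎-dec_)
import Relation.Unary as Unary

private
  variable
    c ℓ : Level
    n : ℕ

------------------------------------------------------------------------
-- The real numbers as Cauchy sequences of rationals; equality of reals
-- is the setoid relation _≈ℝ_, "the difference tends to 0".

IsCauchy : (ℕ → ℚ) → Set
IsCauchy s = ∀ ε → 0ℚ ℚ.< ε →
  ∃ λ N → ∀ m n → N ℕ.≤ m → N ℕ.≤ n → ℚ.∣ s m ℚ.- s n ∣ ℚ.≤ ε

record ℝ : Set where
  constructor mkℝ
  field
    seq    : ℕ → ℚ
    cauchy : IsCauchy seq

open ℝ public

infix 4 _≈ℝ_

_≈ℝ_ : Rel ℝ 0ℓ
x ≈ℝ y = ∀ ε → 0ℚ ℚ.< ε →
  ∃ λ N → ∀ n → N ℕ.≤ n → ℚ.∣ seq x n ℚ.- seq y n ∣ ℚ.≤ ε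

module ℚ-Lemmas where
  0<* : ∀ {p q} → 0ℚ ℚ.< p → 0ℚ ℚ.< q → 0ℚ ℚ.< p ℚ.* q
  0<* {p} {q} 0<p 0<q = ℚₚ.positive⁻¹ (p ℚ.* q)
    {{ℚₚ.pos*pos⇒pos p {{ℚ.positive 0<p}} q {{ℚ.positive 0<q}}}}

  *-mono : ∀ {p q r s} → 0ℚ ℚ.≤ r → 0ℚ ℚ.≤ q → p ℚ.≤ q → r ℚ.≤ s → p ℚ.* r ℚ.≤ q ℚ.* s
  *-mono {q = q} {r} 0≤r 0≤q p≤q r≤s = ℚₚ.≤-trans
    (ℚₚ.*-monoʳ-≤-nonNeg r {{ℚ.nonNegative 0≤r}} p≤q)
    (ℚₚ.*-monoˡ-≤-nonNeg q {{ℚ.nonNegative 0≤q}} r≤s)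

  module _ where
    open ℚ-Solver

    +-difference : ∀ a b c d → (a ℚ.+ b) ℚ.- (c ℚ.+ d) ≡ (a ℚ.- c) ℚ.+ (b ℚ.- d)
    +-difference = solve 4 (λ a b c d → (a :+ b) :- (c :+ d) := (a :- c) :+ (b :- d)) refl

    *-difference : ∀ a b c d → a ℚ.* b ℚ.- c ℚ.* d ≡ a ℚ.* (b ℚ.- d) ℚ.+ d ℚ.* (a ℚ.- c)
    *-difference = solve 4 (λ a b c d → a :* b :- c :* d := a :* (b :- d) :+ d :* (a :- c)) refl

    recip-difference : ∀ a b c d → a ℚ.* (b ℚ.* d) ℚ.- b ℚ.* (a ℚ.* c) ≡ (a ℚ.* b) ℚ.* (d ℚ.- c)
    recip-difference = solve 4 (λ a b c d → a :* (b :* d) :- b :* (a :* c) := (a :* b) :* (d :- c)) refl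

    *-regroup : ∀ a b d e → (a ℚ.* b) ℚ.* (d ℚ.* (d ℚ.* e)) ≡ (a ℚ.* d) ℚ.* (b ℚ.* d) ℚ.* e
    *-regroup = solve 4 (λ a b d e → (a :* b) :* (d :* (d :* e)) := ((a :* d) :* (b :* d)) :* e) refl

    -+-cancel : ∀ a b → a ≡ (a ℚ.- b) ℚ.+ b
    -+-cancel = solve 2 (λ a b → a := (a :- b) :+ b) refl

    +-∸-cancel : ∀ a b → (a ℚ.+ b) ℚ.- b ≡ a
    +-∸-cancel = solve 2 (λ a b → (a :+ b) :- b := a) refl

    neg-difference : ∀ a b → ℚ.- (a ℚ.- b) ≡ b ℚ.- a
    neg-difference = solve 2 (λ a b → :- (a :- b) := b :- a) refl

  divide : ∀ {K ε} → 0ℚ ℚ.< K → 0ℚ ℚ.< ε → ∃ λ δ → 0ℚ ℚ.< δ × K ℚ.* δ ≡ ε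
  divide {K} {ε} 0<K 0<ε = 1/K ℚ.* ε , 0<* (ℚₚ.positive⁻¹ 1/K {{ℚₚ.1/pos⇒pos K {{K>0}}}}) 0<ε , (begin
    K ℚ.* (1/K ℚ.* ε)  ≡⟨ ℚₚ.*-assoc K 1/K ε ⟨
    K ℚ.* 1/K ℚ.* ε    ≡⟨ cong (ℚ._* ε) (ℚₚ.*-inverseʳ K {{K≢0}}) ⟩
    1ℚ ℚ.* ε           ≡⟨ ℚₚ.*-identityˡ ε ⟩
    ε                  ∎)
    where
    open ≡-Reasoning
    K>0 = ℚ.positive 0<K
    K≢0 = ℚₚ.pos⇒nonZero K {{K>0}}
    1/K = (ℚ.1/ K) {{K≢0}}

  0<½ : 0ℚ ℚ.< ½
  0<½ = ℚₚ.positive⁻¹ ½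

open ℚ-Lemmas

constant-cauchy : ∀ q → IsCauchy (λ _ → q)
constant-cauchy q ε 0<ε = 0 , λ _ _ _ _ →
  subst (λ d → ℚ.∣ d ∣ ℚ.≤ ε) (sym (ℚₚ.+-inverseʳ q)) (ℚₚ.<⇒≤ 0<ε)

+-cauchy : ∀ {s t} → IsCauchy s → IsCauchy t → IsCauchy (λ n → s n ℚ.+ t n)
+-cauchy {s} {t} cs ct ε 0<ε = M ℕ.⊔ N , bound
  where
  0<ε/2 = 0<* 0<½ 0<ε
  M = proj₁ (cs (½ ℚ.* ε) 0<ε/2)
  N = proj₁ (ct (½ ℚ.* ε) 0<ε/2)
  open ℚₚ.≤-Reasoning
  bound : ∀ m n → M ℕ.⊔ N ℕ.≤ m → M ℕ.⊔ N ℕ.≤ n →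
          ℚ.∣ (s m ℚ.+ t m) ℚ.- (s n ℚ.+ t n) ∣ ℚ.≤ ε
  bound m n hm hn = begin
    ℚ.∣ (s m ℚ.+ t m) ℚ.- (s n ℚ.+ t n) ∣
      ≡⟨ cong ℚ.∣_∣ (+-difference (s m) (t m) (s n) (t n)) ⟩
    ℚ.∣ (s m ℚ.- s n) ℚ.+ (t m ℚ.- t n) ∣
      ≤⟨ ℚₚ.∣p+q∣≤∣p∣+∣q∣ (s m ℚ.- s n) (t m ℚ.- t n) ⟩
    ℚ.∣ s m ℚ.- s n ∣ ℚ.+ ℚ.∣ t m ℚ.- t n ∣
      ≤⟨ ℚₚ.+-mono-≤ (proj₂ (cs _ 0<ε/2) m n (ℕₚ.m⊔n≤o⇒m≤o M N hm) (ℕₚ.m⊔n≤o⇒m≤o M N hn))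
                     (proj₂ (ct _ 0<ε/2) m n (ℕₚ.m⊔n≤o⇒n≤o M N hm) (ℕₚ.m⊔n≤o⇒n≤o M N hn)) ⟩
    ½ ℚ.* ε ℚ.+ ½ ℚ.* ε
      ≡⟨ ℚₚ.*-distribʳ-+ ε ½ ½ ⟨
    1ℚ ℚ.* ε
      ≡⟨ ℚₚ.*-identityˡ ε ⟩
    ε ∎

neg-cauchy : ∀ {s} → IsCauchy s → IsCauchy (λ n → ℚ.- s n)
neg-cauchy {s} cs ε 0<ε = proj₁ (cs ε 0<ε) , λ m n hm hn →
  subst (ℚ._≤ ε)
    (trans (sym (ℚₚ.∣-p∣≡∣p∣ (s m ℚ.- s n))) (cong ℚ.∣_∣ (ℚₚ.neg-distrib-+ (s m) (ℚ.- s n))))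
    (proj₂ (cs ε 0<ε) m n hm hn)

EventuallyBounded : (ℕ → ℚ) → Set
EventuallyBounded s = ∃ λ B → 0ℚ ℚ.< B × (∃ λ N → ∀ n → N ℕ.≤ n → ℚ.∣ s n ∣ ℚ.≤ B)

cauchy-bounded : ∀ {s} → IsCauchy s → EventuallyBounded s
cauchy-bounded {s} cs = 1ℚ ℚ.+ ℚ.∣ s N ∣ , 0<B , N , bound
  where
  0<1 = ℚₚ.positive⁻¹ 1ℚ
  N = proj₁ (cs 1ℚ 0<1)
  0<B : 0ℚ ℚ.< 1ℚ ℚ.+ ℚ.∣ s N ∣
  0<B = ℚₚ.+-mono-<-≤ 0<1 (ℚₚ.0≤∣p∣ (s N))
  open ℚₚ.≤-Reasoning
  bound : ∀ n → N ℕ.≤ n → ℚ.∣ s n ∣ ℚ.≤ 1ℚ ℚ.+ ℚ.∣ s N ∣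
  bound n hn = begin
    ℚ.∣ s n ∣
      ≡⟨ cong ℚ.∣_∣ (-+-cancel (s n) (s N)) ⟩
    ℚ.∣ (s n ℚ.- s N) ℚ.+ s N ∣
      ≤⟨ ℚₚ.∣p+q∣≤∣p∣+∣q∣ (s n ℚ.- s N) (s N) ⟩
    ℚ.∣ s n ℚ.- s N ∣ ℚ.+ ℚ.∣ s N ∣
      ≤⟨ ℚₚ.+-monoˡ-≤ ℚ.∣ s N ∣ (proj₂ (cs 1ℚ 0<1) n N hn ℕₚ.≤-refl) ⟩
    1ℚ ℚ.+ ℚ.∣ s N ∣ ∎

*-cauchy : ∀ {s t} → IsCauchy s → IsCauchy t → IsCauchy (λ n → s n ℚ.* t n)
*-cauchy {s} {t} cs ct ε 0<ε = combine (cauchy-bounded cs) (cauchy-bounded ct)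
  where
  combine : EventuallyBounded s → EventuallyBounded t →
            ∃ λ N → ∀ m n → N ℕ.≤ m → N ℕ.≤ n → ℚ.∣ s m ℚ.* t m ℚ.- s n ℚ.* t n ∣ ℚ.≤ ε
  combine (A , 0<A , M₀ , boundA) (B , 0<B , N₀ , boundB) with divide (ℚₚ.+-mono-< 0<A 0<B) 0<ε
  ... | δ , 0<δ , Kδ≡ε = (M₀ ℕ.⊔ N₀) ℕ.⊔ (M ℕ.⊔ N) , bound
    where
    M = proj₁ (cs δ 0<δ)
    N = proj₁ (ct δ 0<δ)
    open ℚₚ.≤-Reasoning
    bound : ∀ m n → (M₀ ℕ.⊔ N₀) ℕ.⊔ (M ℕ.⊔ N) ℕ.≤ m → (M₀ ℕ.⊔ N₀) ℕ.⊔ (M ℕ.⊔ N) ℕ.≤ n →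
            ℚ.∣ s m ℚ.* t m ℚ.- s n ℚ.* t n ∣ ℚ.≤ ε
    bound m n hm hn = begin
      ℚ.∣ s m ℚ.* t m ℚ.- s n ℚ.* t n ∣
        ≡⟨ cong ℚ.∣_∣ (*-difference (s m) (t m) (s n) (t n)) ⟩
      ℚ.∣ s m ℚ.* (t m ℚ.- t n) ℚ.+ t n ℚ.* (s m ℚ.- s n) ∣
        ≤⟨ ℚₚ.∣p+q∣≤∣p∣+∣q∣ (s m ℚ.* (t m ℚ.- t n)) (t n ℚ.* (s m ℚ.- s n)) ⟩
      ℚ.∣ s m ℚ.* (t m ℚ.- t n) ∣ ℚ.+ ℚ.∣ t n ℚ.* (s m ℚ.- s n) ∣
        ≡⟨ cong₂ ℚ._+_ (ℚₚ.∣p*q∣≡∣p∣*∣q∣ (s m) (t m ℚ.- t n)) (ℚₚ.∣p*q∣≡∣p∣*∣q∣ (t n) (s m ℚ.- s n)) ⟩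
      ℚ.∣ s m ∣ ℚ.* ℚ.∣ t m ℚ.- t n ∣ ℚ.+ ℚ.∣ t n ∣ ℚ.* ℚ.∣ s m ℚ.- s n ∣
        ≤⟨ ℚₚ.+-mono-≤
             (*-mono (ℚₚ.0≤∣p∣ (t m ℚ.- t n)) (ℚₚ.<⇒≤ 0<A) (boundA m (ℕₚ.m⊔n≤o⇒m≤o M₀ N₀ hm₀))
               (proj₂ (ct δ 0<δ) m n (ℕₚ.m⊔n≤o⇒n≤o M N hm₁) (ℕₚ.m⊔n≤o⇒n≤o M N hn₁)))
             (*-mono (ℚₚ.0≤∣p∣ (s m ℚ.- s n)) (ℚₚ.<⇒≤ 0<B) (boundB n (ℕₚ.m⊔n≤o⇒n≤o M₀ N₀ hn₀))
               (proj₂ (cs δ 0<δ) m n (ℕₚ.m⊔n≤o⇒m≤o M N hm₁) (ℕₚ.m⊔n≤o⇒m≤o M N hn₁))) ⟩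
      A ℚ.* δ ℚ.+ B ℚ.* δ
        ≡⟨ ℚₚ.*-distribʳ-+ δ A B ⟨
      (A ℚ.+ B) ℚ.* δ
        ≡⟨ Kδ≡ε ⟩
      ε ∎
      where
      hm₀ = ℕₚ.m⊔n≤o⇒m≤o (M₀ ℕ.⊔ N₀) (M ℕ.⊔ N) hm
      hn₀ = ℕₚ.m⊔n≤o⇒m≤o (M₀ ℕ.⊔ N₀) (M ℕ.⊔ N) hn
      hm₁ = ℕₚ.m⊔n≤o⇒n≤o (M₀ ℕ.⊔ N₀) (M ℕ.⊔ N) hm
      hn₁ = ℕₚ.m⊔n≤o⇒n≤o (M₀ ℕ.⊔ N₀) (M ℕ.⊔ N) hn

fromℚ : ℚ → ℝ
fromℚ q = mkℝ (λ _ → q) (constant-cauchy q)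

ℝ-rawRing : RawRing 0ℓ 0ℓ
ℝ-rawRing = record
  { Carrier = ℝ
  ; _≈_     = _≈ℝ_
  ; _+_     = λ x y → mkℝ (λ n → seq x n ℚ.+ seq y n) (+-cauchy {seq x} {seq y} (cauchy x) (cauchy y))
  ; _*_     = λ x y → mkℝ (λ n → seq x n ℚ.* seq y n) (*-cauchy {seq x} {seq y} (cauchy x) (cauchy y))
  ; -_      = λ x → mkℝ (λ n → ℚ.- seq x n) (neg-cauchy {seq x} (cauchy x))
  ; 0#      = fromℚ 0ℚ
  ; 1#      = fromℚ 1ℚ
  }

------------------------------------------------------------------------
-- Reciprocals of reals bounded away from 0

Apart₀ : ℝ → Set
Apart₀ x = ∃ λ δ → 0ℚ ℚ.< δ × (∃ λ N → ∀ n → N ℕ.≤ n → δ ℚ.≤ ℚ.∣ seq x n ∣)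

-- The value at 0 is irrelevant: a sequence bounded away from 0 has only
-- finitely many zero terms.
recipℚ : ℚ → ℚ
recipℚ p with p ℚₚ.≟ 0ℚ
... | yes _   = 0ℚ
... | no  p≢0 = (ℚ.1/ p) {{ℚ.≢-nonZero p≢0}}

recipℚ-inverse : ∀ {δ p} → 0ℚ ℚ.< δ → δ ℚ.≤ ℚ.∣ p ∣ → recipℚ p ℚ.* p ≡ 1ℚ
recipℚ-inverse {p = p} 0<δ δ≤∣p∣ with p ℚₚ.≟ 0ℚ
... | yes refl = contradiction (ℚₚ.<-≤-trans 0<δ δ≤∣p∣) (ℚₚ.<-irrefl refl)
... | no  p≢0  = ℚₚ.*-inverseˡ p {{ℚ.≢-nonZero p≢0}}

recip-cauchy : (x : ℝ) → Apart₀ x → IsCauchy (λ n → recipℚ (seq x n))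
recip-cauchy x (δ , 0<δ , N₀ , apart) ε 0<ε = N₀ ℕ.⊔ N , bound
  where
  s = seq x
  r : ℕ → ℚ
  r n = recipℚ (s n)
  η = δ ℚ.* (δ ℚ.* ε)
  0<η = 0<* 0<δ (0<* 0<δ 0<ε)
  N = proj₁ (cauchy x η 0<η)
  open ℚₚ.≤-Reasoning
  r-bound : ∀ n → N₀ ℕ.≤ n → ℚ.∣ r n ∣ ℚ.* δ ℚ.≤ 1ℚ
  r-bound n hn = begin
    ℚ.∣ r n ∣ ℚ.* δ          ≤⟨ ℚₚ.*-monoˡ-≤-nonNeg ℚ.∣ r n ∣ {{ℚₚ.∣-∣-nonNeg (r n)}} (apart n hn) ⟩
    ℚ.∣ r n ∣ ℚ.* ℚ.∣ s n ∣  ≡⟨ ℚₚ.∣p*q∣≡∣p∣*∣q∣ (r n) (s n) ⟨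
    ℚ.∣ r n ℚ.* s n ∣        ≡⟨ cong ℚ.∣_∣ (recipℚ-inverse 0<δ (apart n hn)) ⟩
    1ℚ ∎
  0≤rδ : ∀ n → 0ℚ ℚ.≤ ℚ.∣ r n ∣ ℚ.* δ
  0≤rδ n = ℚₚ.nonNegative⁻¹ _ {{ℚₚ.nonNeg*nonNeg⇒nonNeg ℚ.∣ r n ∣ {{ℚₚ.∣-∣-nonNeg (r n)}} δ {{ℚ.nonNegative (ℚₚ.<⇒≤ 0<δ)}}}}
  0≤1 : 0ℚ ℚ.≤ 1ℚ
  0≤1 = ℚₚ.nonNegative⁻¹ 1ℚ
  difference : ∀ m n → N₀ ℕ.≤ m → N₀ ℕ.≤ n → r m ℚ.- r n ≡ (r m ℚ.* r n) ℚ.* (s n ℚ.- s m)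
  difference m n hm hn = begin-equality
    r m ℚ.- r n
      ≡⟨ cong₂ ℚ._-_ (ℚₚ.*-identityʳ (r m)) (ℚₚ.*-identityʳ (r n)) ⟨
    r m ℚ.* 1ℚ ℚ.- r n ℚ.* 1ℚ
      ≡⟨ cong₂ (λ a b → r m ℚ.* a ℚ.- r n ℚ.* b) (recipℚ-inverse 0<δ (apart n hn)) (recipℚ-inverse 0<δ (apart m hm)) ⟨
    r m ℚ.* (r n ℚ.* s n) ℚ.- r n ℚ.* (r m ℚ.* s m)
      ≡⟨ recip-difference (r m) (r n) (s m) (s n) ⟩
    (r m ℚ.* r n) ℚ.* (s n ℚ.- s m) ∎
  bound : ∀ m n → N₀ ℕ.⊔ N ℕ.≤ m → N₀ ℕ.⊔ N ℕ.≤ n → ℚ.∣ r m ℚ.- r n ∣ ℚ.≤ ε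
  bound m n hm hn = begin
    ℚ.∣ r m ℚ.- r n ∣
      ≡⟨ cong ℚ.∣_∣ (difference m n hm₀ hn₀) ⟩
    ℚ.∣ (r m ℚ.* r n) ℚ.* (s n ℚ.- s m) ∣
      ≡⟨ ℚₚ.∣p*q∣≡∣p∣*∣q∣ (r m ℚ.* r n) (s n ℚ.- s m) ⟩
    ℚ.∣ r m ℚ.* r n ∣ ℚ.* ℚ.∣ s n ℚ.- s m ∣
      ≤⟨ ℚₚ.*-monoˡ-≤-nonNeg ℚ.∣ r m ℚ.* r n ∣ {{ℚₚ.∣-∣-nonNeg (r m ℚ.* r n)}}
           (proj₂ (cauchy x η 0<η) n m (ℕₚ.m⊔n≤o⇒n≤o N₀ N hn) (ℕₚ.m⊔n≤o⇒n≤o N₀ N hm)) ⟩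
    ℚ.∣ r m ℚ.* r n ∣ ℚ.* η
      ≡⟨ cong (ℚ._* η) (ℚₚ.∣p*q∣≡∣p∣*∣q∣ (r m) (r n)) ⟩
    (ℚ.∣ r m ∣ ℚ.* ℚ.∣ r n ∣) ℚ.* (δ ℚ.* (δ ℚ.* ε))
      ≡⟨ *-regroup ℚ.∣ r m ∣ ℚ.∣ r n ∣ δ ε ⟩
    (ℚ.∣ r m ∣ ℚ.* δ) ℚ.* (ℚ.∣ r n ∣ ℚ.* δ) ℚ.* ε
      ≤⟨ ℚₚ.*-monoʳ-≤-nonNeg ε {{ℚ.nonNegative (ℚₚ.<⇒≤ 0<ε)}}
           (*-mono (0≤rδ n) 0≤1 (r-bound m hm₀) (r-bound n hn₀)) ⟩
    1ℚ ℚ.* ε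
      ≡⟨ ℚₚ.*-identityˡ ε ⟩
    ε ∎
    where
    hm₀ = ℕₚ.m⊔n≤o⇒m≤o N₀ N hm
    hn₀ = ℕₚ.m⊔n≤o⇒m≤o N₀ N hn

recip : (x : ℝ) → Apart₀ x → ℝ
recip x x#0 = mkℝ (λ n → recipℚ (seq x n)) (recip-cauchy x x#0)

------------------------------------------------------------------------
-- Square roots of natural numbers

-- isqrt m = ⌊√m⌋
isqrt : ℕ → ℕ
isqrt zero = zero
isqrt (suc m) with suc (isqrt m) ℕ.* suc (isqrt m) ℕₚ.≤? suc m
... | yes _ = suc (isqrt m)
... | no  _ = isqrt m

isqrt-spec : ∀ m → isqrt m ℕ.* isqrt m ℕ.≤ m × m ℕ.< suc (isqrt m) ℕ.* suc (isqrt m)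
isqrt-spec zero = ℕ.z≤n , ℕ.z<s
isqrt-spec (suc m) with suc (isqrt m) ℕ.* suc (isqrt m) ℕₚ.≤? suc m
... | yes r²≤m = r²≤m , ℕₚ.≤-<-trans (proj₂ (isqrt-spec m))
                          (ℕₚ.*-mono-< (ℕₚ.n<1+n (suc (isqrt m))) (ℕₚ.n<1+n (suc (isqrt m))))
... | no  r²≰m = ℕₚ.m≤n⇒m≤1+n (proj₁ (isqrt-spec m)) , ℕₚ.≰⇒> r²≰m

√-numerator : ℕ → ℕ → ℕ
√-numerator m n = isqrt (m ℕ.* (suc n ℕ.* suc n))

-- The n-th term is ⌊(n+1)√m⌋ / (n+1), which is within 1/(n+1) of √m.
√-seq : ℕ → ℕ → ℚ
√-seq m n = + √-numerator m n ℚ./ suc n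

module √-Lemmas where
  square-cancel-< : ∀ {a b} → a ℕ.* a ℕ.< b ℕ.* b → a ℕ.< b
  square-cancel-< {a} {b} a²<b² with a ℕₚ.<? b
  ... | yes a<b = a<b
  ... | no  a≮b = contradiction a²<b² (ℕₚ.≤⇒≯ (ℕₚ.*-mono-≤ (ℕₚ.≮⇒≥ a≮b) (ℕₚ.≮⇒≥ a≮b)))

  fromℚᵘ-mono-≤ : ∀ {p q} → p ℚᵘ.≤ q → ℚ.fromℚᵘ p ℚ.≤ ℚ.fromℚᵘ q
  fromℚᵘ-mono-≤ {p} {q} p≤q = ℚₚ.toℚᵘ-cancel-≤ (ℚᵘₚ.≤-trans (ℚᵘₚ.≤-reflexive (ℚₚ.toℚᵘ-fromℚᵘ p))
    (ℚᵘₚ.≤-trans p≤q (ℚᵘₚ.≤-reflexive (ℚᵘₚ.≃-sym (ℚₚ.toℚᵘ-fromℚᵘ q)))))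

  /-mono-≤ : ∀ a k b l → a ℕ.* suc l ℕ.≤ b ℕ.* suc k → + a ℚ./ suc k ℚ.≤ + b ℚ./ suc l
  /-mono-≤ a k b l h = fromℚᵘ-mono-≤ {ℚᵘ.mkℚᵘ (+ a) k} {ℚᵘ.mkℚᵘ (+ b) l}
    (ℚᵘ.*≤* (subst (ℤ._≤ + b ℤ.* + suc k) (ℤₚ.pos-* a (suc l))
      (subst (+ (a ℕ.* suc l) ℤ.≤_) (ℤₚ.pos-* b (suc k)) (ℤ.+≤+ h))))

  /-suc : ∀ b l → + suc b ℚ./ suc l ≡ + 1 ℚ./ suc l ℚ.+ + b ℚ./ suc l
  /-suc b l = ℚₚ.toℚᵘ-injective (begin
    ℚ.toℚᵘ (+ suc b ℚ./ suc l)
      ≈⟨ ℚₚ.toℚᵘ-fromℚᵘ (ℚᵘ.mkℚᵘ (+ suc b) l) ⟩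
    ℚᵘ.mkℚᵘ (+ suc b) l
      ≈⟨ ℚᵘ.*≡* eq ⟩
    ℚᵘ.mkℚᵘ (+ 1) l ℚᵘ.+ ℚᵘ.mkℚᵘ (+ b) l
      ≈⟨ ℚᵘₚ.+-cong (ℚₚ.toℚᵘ-fromℚᵘ (ℚᵘ.mkℚᵘ (+ 1) l)) (ℚₚ.toℚᵘ-fromℚᵘ (ℚᵘ.mkℚᵘ (+ b) l)) ⟨
    ℚ.toℚᵘ (+ 1 ℚ./ suc l) ℚᵘ.+ ℚ.toℚᵘ (+ b ℚ./ suc l)
      ≈⟨ ℚₚ.toℚᵘ-homo-+ (+ 1 ℚ./ suc l) (+ b ℚ./ suc l) ⟨
    ℚ.toℚᵘ (+ 1 ℚ./ suc l ℚ.+ + b ℚ./ suc l) ∎)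
    where
    open ℚᵘₚ.≃-Reasoning
    eq : + suc b ℤ.* + (suc l ℕ.* suc l) ≡ (+ 1 ℤ.* + suc l ℤ.+ + b ℤ.* + suc l) ℤ.* + suc l
    eq = trans (cong (+ suc b ℤ.*_) (ℤₚ.pos-* (suc l) (suc l)))
         (trans (sym (ℤₚ.*-assoc (+ suc b) (+ suc l) (+ suc l)))
           (cong (ℤ._* + suc l) (ℤₚ.*-distribʳ-+ (+ suc l) (+ 1) (+ b))))

  √-step : ∀ m k l → √-seq m k ℚ.≤ + 1 ℚ./ suc l ℚ.+ √-seq m l
  √-step m k l = subst (√-seq m k ℚ.≤_) (/-suc b l) (/-mono-≤ a k (suc b) l (ℕₚ.<⇒≤ (square-cancel-< squares)))
    where
    open ℕₚ.≤-Reasoning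
    open ℕ-Solver
    K = suc k
    L = suc l
    a = √-numerator m k
    b = √-numerator m l
    squares : (a ℕ.* L) ℕ.* (a ℕ.* L) ℕ.< (suc b ℕ.* K) ℕ.* (suc b ℕ.* K)
    squares = begin-strict
      (a ℕ.* L) ℕ.* (a ℕ.* L)
        ≡⟨ solve 2 (λ x y → (x :* y) :* (x :* y) := (x :* x) :* (y :* y)) refl a L ⟩
      (a ℕ.* a) ℕ.* (L ℕ.* L)
        ≤⟨ ℕₚ.*-monoˡ-≤ (L ℕ.* L) (proj₁ (isqrt-spec (m ℕ.* (K ℕ.* K)))) ⟩
      (m ℕ.* (K ℕ.* K)) ℕ.* (L ℕ.* L)
        ≡⟨ solve 3 (λ x y z → (x :* y) :* z := (x :* z) :* y) refl m (K ℕ.* K) (L ℕ.* L) ⟩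
      (m ℕ.* (L ℕ.* L)) ℕ.* (K ℕ.* K)
        <⟨ ℕₚ.*-monoˡ-< (K ℕ.* K) (proj₂ (isqrt-spec (m ℕ.* (L ℕ.* L)))) ⟩
      (suc b ℕ.* suc b) ℕ.* (K ℕ.* K)
        ≡⟨ solve 2 (λ x y → (x :* x) :* (y :* y) := (x :* y) :* (x :* y)) refl (suc b) K ⟩
      (suc b ℕ.* K) ℕ.* (suc b ℕ.* K) ∎

  archimedean : ∀ ε → 0ℚ ℚ.< ε → ∃ λ N → ∀ n → N ℕ.≤ n → + 1 ℚ./ suc n ℚ.≤ ε
  archimedean ε 0<ε with ε | ℚ.positive 0<ε
  ... | mkℚ +[1+ p ] d c | _ = d , λ n d≤n →
    subst (+ 1 ℚ./ suc n ℚ.≤_) (ℚₚ.fromℚᵘ-toℚᵘ (mkℚ +[1+ p ] d c))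
      (/-mono-≤ 1 n (suc p) d (ℕₚ.*-mono-≤ (s≤s (ℕ.z≤n {p})) (s≤s d≤n)))

  ∣-∣-bound : ∀ {a b ε} → a ℚ.≤ ε ℚ.+ b → b ℚ.≤ ε ℚ.+ a → ℚ.∣ a ℚ.- b ∣ ℚ.≤ ε
  ∣-∣-bound {a} {b} {ε} a≤ b≤ with ℚₚ.∣p∣≡p∨∣p∣≡-p (a ℚ.- b)
  ... | inj₁ eq = subst (ℚ._≤ ε) (sym eq)
        (subst (a ℚ.- b ℚ.≤_) (+-∸-cancel ε b) (ℚₚ.+-monoˡ-≤ (ℚ.- b) a≤))
  ... | inj₂ eq = subst (ℚ._≤ ε) (sym (trans eq (neg-difference a b)))
        (subst (b ℚ.- a ℚ.≤_) (+-∸-cancel ε a) (ℚₚ.+-monoˡ-≤ (ℚ.- a) b≤))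

open √-Lemmas

√-cauchy : ∀ m → IsCauchy (√-seq m)
√-cauchy m ε 0<ε with N , small ← archimedean ε 0<ε = N , λ k l hk hl → ∣-∣-bound
  (ℚₚ.≤-trans (√-step m k l) (ℚₚ.+-monoˡ-≤ (√-seq m l) (small l hl)))
  (ℚₚ.≤-trans (√-step m l k) (ℚₚ.+-monoˡ-≤ (√-seq m k) (small k hk)))

√_ : ℕ → ℝ
√ m = mkℝ (√-seq m) (√-cauchy m)

√-apart₀ : ∀ m .{{_ : ℕ.NonZero m}} → Apart₀ (√ m)
√-apart₀ m = 1ℚ , ℚₚ.positive⁻¹ 1ℚ , 0 , λ n _ →
  let r = √-numerator m n
      n<1+r : suc n ℕ.< suc r
      n<1+r = square-cancel-< (ℕₚ.≤-<-trans (ℕₚ.m≤n*m (suc n ℕ.* suc n) m)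
                                             (proj₂ (isqrt-spec (m ℕ.* (suc n ℕ.* suc n)))))
      1≤ : 1ℚ ℚ.≤ √-seq m n
      1≤ = /-mono-≤ 1 0 r n (subst (ℕ._≤ r ℕ.* 1) (sym (ℕₚ.*-identityˡ (suc n)))
             (subst (suc n ℕ.≤_) (sym (ℕₚ.*-identityʳ r)) (ℕ.s≤s⁻¹ n<1+r)))
  in subst (1ℚ ℚ.≤_) (sym (ℚₚ.0≤p⇒∣p∣≡p (ℚₚ.≤-trans (ℚₚ.nonNegative⁻¹ 1ℚ) 1≤))) 1≤

1/√_ : ∀ m .{{_ : ℕ.NonZero m}} → ℝ
1/√ m = recip (√ m) (√-apart₀ m)

------------------------------------------------------------------------
-- Polynomials in one variable: lists of coefficients, constant term
-- first, compared coefficientwise (so trailing zeros do not matter).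

module Polynomial (R : RawRing c ℓ) where
  open RawRing R

  Poly : Set c
  Poly = List Carrier

  coeff : Poly → ℕ → Carrier
  coeff []      _       = 0#
  coeff (a ∷ _) zero    = a
  coeff (_ ∷ p) (suc k) = coeff p k

  infix  4 _≈ₚ_
  infixl 6 _+ₚ_
  infixl 7 _*ₚ_

  _≈ₚ_ : Rel Poly ℓ
  p ≈ₚ q = ∀ k → coeff p k ≈ coeff q k

  _+ₚ_ : Poly → Poly → Poly
  []      +ₚ q       = q
  (a ∷ p) +ₚ []      = a ∷ p
  (a ∷ p) +ₚ (b ∷ q) = (a + b) ∷ (p +ₚ q)

  _*ₚ_ : Poly → Poly → Poly
  []      *ₚ q = []
  (a ∷ p) *ₚ q = map (a *_) q +ₚ (0# ∷ (p *ₚ q))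

  const : Carrier → Poly
  const a = [ a ]

  X : Poly
  X = 0# ∷ 1# ∷ []

  rawRing : RawRing c ℓ
  rawRing = record
    { Carrier = Poly
    ; _≈_     = _≈ₚ_
    ; _+_     = _+ₚ_
    ; _*_     = _*ₚ_
    ; -_      = map (-_)
    ; 0#      = []
    ; 1#      = const 1#
    }

------------------------------------------------------------------------
-- Matrices

Matrix : Set c → ℕ → Set c
Matrix A n = Fin n → Fin n → A

module Determinant (R : RawRing c ℓ) where
  open RawRing R
  open RawSemiringDefinitions rawSemiring using (sum; _^_)

  identity : Matrix Carrier n
  identity i j = if does (i Fin.≟ j) then 1# else 0#

  -- Laplace expansion along the first row
  det : Matrix Carrier n → Carrier
  det {zero}  A = 1#
  det {suc n} A = sum λ j →
    (- 1#) ^ toℕ j * A fzero j * det (λ i k → A (fsuc i) (punchIn j k))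

open Polynomial ℝ-rawRing public using (const) renaming (Poly to ℝ[λ]; X to λ̂)

ℝ[λ]-rawRing : RawRing 0ℓ 0ℓ
ℝ[λ]-rawRing = Polynomial.rawRing ℝ-rawRing

open RawRing ℝ[λ]-rawRing public using (_≈_; _+_; _*_; -_; 1#)

infixl 6 _-_

_-_ : ℝ[λ] → ℝ[λ] → ℝ[λ]
p - q = p + (- q)

charPoly : Matrix ℝ n → ℝ[λ]
charPoly A = det λ i j → λ̂ * identity i j - const (A i j)
  where open Determinant ℝ[λ]-rawRing

------------------------------------------------------------------------
-- Finite simple graphs on the vertex set Fin n

record Graph (n : ℕ) : Set₁ where
  field
    Adj    : Rel (Fin n) 0ℓ
    adj?   : Decidable Adj
    symm   : Symmetric Adj
    irrefl : Irreflexive _≡_ Adj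

  degree : Fin n → ℕ
  degree i = count (adj? i) (allFin n)

private
  count-nonZero : ∀ {A : Set} {P : Unary.Pred A 0ℓ} (P? : Unary.Decidable P) {m} {x : A} {xs : Vec A m} →
                  x ∈ xs → P x → ℕ.NonZero (count P? xs)
  count-nonZero P? {xs = y ∷ ys} x∈ px with P? y | x∈
  ... | yes _  | _           = _
  ... | no ¬py | here refl   = contradiction px ¬py
  ... | no _   | there x∈ys  = count-nonZero P? x∈ys px

module _ (G : Graph n) where
  open Graph G

  degree-nonZero : ∀ {i j} → Adj i j → ℕ.NonZero (degree i)
  degree-nonZero {i} {j} = count-nonZero (adj? i) (∈-allFin⁺ j)

  degree*-nonZero : ∀ {i j} → Adj i j → ℕ.NonZero (degree i ℕ.* degree j)
  degree*-nonZero {i} {j} a =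
    ℕₚ.m*n≢0 (degree i) (degree j) {{degree-nonZero a}} {{degree-nonZero (symm a)}}

  randićMatrix : Matrix ℝ n
  randićMatrix i j with adj? i j
  ... | yes a = (1/√ (degree i ℕ.* degree j)) {{degree*-nonZero a}}
  ... | no  _ = fromℚ 0ℚ

  RP : ℝ[λ]
  RP = charPoly randićMatrix

path : (n : ℕ) → Graph n
path n = record
  { Adj    = λ i j → toℕ j ≡ suc (toℕ i) ⊎ toℕ i ≡ suc (toℕ j)
  ; adj?   = λ i j → (toℕ j ℕₚ.≟ suc (toℕ i)) ⊎-dec (toℕ i ℕₚ.≟ suc (toℕ j))
  ; symm   = swap
  ; irrefl = λ where
      refl (inj₁ i≡1+i) → ℕₚ.1+n≢n (sym i≡1+i)
      refl (inj₂ i≡1+i) → ℕₚ.1+n≢n (sym i≡1+i)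
  }

------------------------------------------------------------------------

¼ : ℝ[λ]
¼ = const (fromℚ (+ 1 ℚ./ 4))

-- The sequence starts at Λ 1; the value Λ 0 is a filler.
Λ : ℕ → ℝ[λ]
Λ 0                   = 1#
Λ 1                   = λ̂
Λ 2                   = λ̂ * λ̂ - ¼
Λ (suc (suc (suc k))) = λ̂ * Λ (suc (suc k)) - ¼ * Λ (suc k)

{-# OPTIONS --safe #-}

-- λI − R(Pₙ) is tridiagonal with diagonal λ, so expanding along the first row
-- gives its determinant as a continuant in which the off-diagonal entries occur
-- only through the products 1/(dᵢ dᵢ₊₁): these are ½ for the two end edges and ¼
-- for all others.  A stretch of k vertices with only ¼'s contributes Λₖ.
-- Splitting off both end vertices gives
--   λ²Λₙ₋₂ − ½λΛₙ₋₃ − ½(λΛₙ₋₃ − ½Λₙ₋₄) = λ²Λₙ₋₂ − (λΛₙ₋₃ − ¼Λₙ₋₄) = (λ² − 1)Λₙ₋₂.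
module Submission where

open import Defs hiding (_≈_; _+_; _*_; -_; 1#; _-_)
open import Algebra.Bundles using (AbelianGroup; CommutativeMonoid; CommutativeRing)
open import Algebra.Bundles.Raw using (RawRing)
import Algebra.Definitions.RawSemiring as RawSemiringDefinitions
import Algebra.Properties.CommutativeSemigroup as CommutativeSemigroupProperties
import Algebra.Properties.Monoid.Sum as Sum
import Algebra.Properties.Ring as RingProperties
import Algebra.Solver.Ring.NaturalCoefficients.Default as SemiringSolver
open import Algebra.Structures using (IsCommutativeRing)
open import Data.Bool.Base using (if_then_else_)
open import Data.Fin.Base using (Fin; toℕ; punchIn; fromℕ<) renaming (zero to fzero; suc to fsuc)
import Data.Fin.Properties as Fin
open import Data.Integer.Base using (+_; +[1+_])
import Data.Integer.Properties as ℤₚ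
open import Data.List.Base using ([]; _∷_; [_]; map)
open import Data.Nat.Base as ℕ using (ℕ; zero; suc; s≤s; z≤n; _≤_; _∸_)
import Data.Nat.Properties as ℕₚ
open import Data.Nat.Solver using () renaming (module +-*-Solver to ℕ-Solver)
open import Data.Product.Base using (∃; _×_; _,_; proj₁; proj₂)
open import Data.Rational.Base as ℚ using (ℚ; mkℚ; 0ℚ; 1ℚ; ½)
import Data.Rational.Properties as ℚₚ
open import Data.Rational.Solver using () renaming (module +-*-Solver to ℚ-Solver)
import Data.Rational.Unnormalised.Base as ℚᵘ
import Data.Rational.Unnormalised.Properties as ℚᵘₚ
open import Data.Sum.Base using (inj₁; inj₂)
open import Data.Vec.Base using (Vec; []; _∷_; count; tabulate; allFin)
open import Function.Base using (_∘_; id)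
open import Level using (Level; 0ℓ; _⊔_)
open import Relation.Binary.PropositionalEquality as ≡ using (_≡_; _≢_)
import Relation.Binary.Reasoning.Setoid as SetoidReasoning
open import Relation.Nullary using (¬_; yes; no; does; contradiction)
open import Relation.Nullary.Decidable using (_⊎-dec_; dec-true; dec-false)
open import Relation.Unary using (Pred; Decidable)

private
  variable
    c ℓ : Level
    n : ℕ

-- The factor λ² - 1 comes from ½ + ½ = 1 and ½ · ½ = ¼ alone, so the algebra takes place in any
-- commutative ring with elements `h` and `q` such that `h + h ≈ 1#` and `h * h ≈ q`. Expansion
-- along the first row removes vertices from the left: the left end edge costs one step of the
-- recursion, whereas the right end edge lies at its bottom and must be carried up through all inner
-- vertices by induction. The value `Λ 0 = 1` turns the formula for Λ₂ into an instance of the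
-- recurrence, which gives this induction its starting point. Of the real numbers only two facts are
-- then required: the commutative ring laws up to `_≈ℝ_`, and that the square of `1/√ m` is the
-- rational 1/m. No square root is ever evaluated.

HasCommutativeRingLaws : RawRing c ℓ → Set (c ⊔ ℓ)
HasCommutativeRingLaws R = IsCommutativeRing _≈_ _+_ _*_ -_ 0# 1#
  where open RawRing R

commutativeRing : (R : RawRing c ℓ) → HasCommutativeRingLaws R → CommutativeRing c ℓ
commutativeRing R isCommutativeRing = record
  { RawRing R
  ; isCommutativeRing = isCommutativeRing
  }

-- Tridiagonal determinants

module TridiagonalDeterminant (R : CommutativeRing c ℓ) where
  open CommutativeRing R
  open Determinant rawRing
  open Sum +-monoid using (sum)
  open RawSemiringDefinitions (RawRing.rawSemiring rawRing) using (_^_)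
  open SetoidReasoning setoid
  open RingProperties ring using (-‿distribˡ-*; -‿distribʳ-*; -‿+-comm; -1*x≈-x)

  minor : Matrix Carrier (suc n) → Fin (suc n) → Matrix Carrier n
  minor A j i k = A (fsuc i) (punchIn j k)

  shift : Matrix Carrier (suc n) → Matrix Carrier n
  shift A i j = A (fsuc i) (fsuc j)

  sum-zero : (f : Fin n → Carrier) → (∀ i → f i ≈ 0#) → sum f ≈ 0#
  sum-zero {zero}  f f≈0 = refl
  sum-zero {suc n} f f≈0 = trans (+-cong (f≈0 fzero) (sum-zero (f ∘ fsuc) (f≈0 ∘ fsuc))) (+-identityˡ 0#)

  zero-entry : ∀ {s a} d → a ≈ 0# → s * a * d ≈ 0#
  zero-entry {s} d a≈0 = trans (*-congʳ (trans (*-congˡ a≈0) (zeroʳ s))) (zeroˡ d)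

  -- The determinant is expanded along rows, so a column needs an induction: the term at column 0
  -- has a zero entry, and every other minor keeps column 0, because `punchIn (fsuc j) fzero` is
  -- `fzero`.
  det-zeroColumn : (A : Matrix Carrier (suc n)) → (∀ i → A i fzero ≈ 0#) → det A ≈ 0#
  det-zeroColumn {n} A A≈0 = sum-zero _ (term A A≈0)
    where
    term : ∀ {n} (A : Matrix Carrier (suc n)) → (∀ i → A i fzero ≈ 0#) → ∀ j →
           (- 1#) ^ toℕ j * A fzero j * det (minor A j) ≈ 0#
    term         A A≈0 fzero    = zero-entry _ (A≈0 fzero)
    term {suc n} A A≈0 (fsuc j) =
      trans (*-congˡ (det-zeroColumn (minor A (fsuc j)) (A≈0 ∘ fsuc))) (zeroʳ _)

  -- Each minor other than the one at column 0 retains the first column without its top entry, that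
  -- is, a zero column.
  det-firstColumn : (A : Matrix Carrier (suc n)) → (∀ i → A (fsuc i) fzero ≈ 0#) →
                    det A ≈ A fzero fzero * det (shift A)
  det-firstColumn {n} A A≈0 = begin
    1# * A fzero fzero * det (shift A) + _
      ≈⟨ +-cong (*-congʳ (*-identityˡ _)) (sum-zero _ (term A A≈0)) ⟩
    A fzero fzero * det (shift A) + 0#
      ≈⟨ +-identityʳ _ ⟩
    A fzero fzero * det (shift A) ∎
    where
    term : ∀ {n} (A : Matrix Carrier (suc n)) → (∀ i → A (fsuc i) fzero ≈ 0#) → ∀ j →
           (- 1#) ^ suc (toℕ j) * A fzero (fsuc j) * det (minor A (fsuc j)) ≈ 0#
    term {suc n} A A≈0 j = trans (*-congˡ (det-zeroColumn (minor A (fsuc j)) A≈0)) (zeroʳ _)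

  -- Only columns 0 and 1 contribute. The minor at column 1 has `A (fsuc fzero) fzero` on top of an
  -- otherwise zero first column, so `det-firstColumn` removes one more row and column.
  det-expand : (A : Matrix Carrier (suc (suc n))) →
               (∀ j → A fzero (fsuc (fsuc j)) ≈ 0#) → (∀ i → A (fsuc (fsuc i)) fzero ≈ 0#) →
               det A ≈ A fzero fzero * det (shift A)
                       - A fzero (fsuc fzero) * A (fsuc fzero) fzero * det (shift (shift A))
  det-expand A row≈0 column≈0 = +-cong (*-congʳ (*-identityˡ _)) (begin
    - 1# * 1# * a * det (minor A (fsuc fzero)) + _
      ≈⟨ +-cong (*-cong (*-congʳ (*-identityʳ _)) (det-firstColumn (minor A (fsuc fzero)) column≈0))
                (sum-zero _ λ j → zero-entry _ (row≈0 j)) ⟩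
    - 1# * a * (b * det (shift (shift A))) + 0#
      ≈⟨ +-identityʳ _ ⟩
    - 1# * a * (b * det (shift (shift A)))
      ≈⟨ *-assoc _ _ _ ⟨
    - 1# * a * b * det (shift (shift A))
      ≈⟨ *-congʳ (*-congʳ (-1*x≈-x a)) ⟩
    - a * b * det (shift (shift A))
      ≈⟨ *-congʳ (-‿distribˡ-* a b) ⟨
    - (a * b) * det (shift (shift A))
      ≈⟨ -‿distribˡ-* (a * b) _ ⟨
    - (a * b * det (shift (shift A))) ∎)
    where
    a = A fzero (fsuc fzero)
    b = A (fsuc fzero) fzero

  -- Only the products w i = A i (i+1) · A (i+1) i of opposite off-diagonal
  -- entries enter the determinant.
  record IsTridiagonal (x : Carrier) (w : ℕ → Carrier) (A : Matrix Carrier n) : Set ℓ where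
    field
      diagonal : ∀ i → A i i ≈ x
      upper    : ∀ i j → suc (suc (toℕ i)) ≤ toℕ j → A i j ≈ 0#
      lower    : ∀ i j → suc (suc (toℕ j)) ≤ toℕ i → A i j ≈ 0#
      product  : ∀ i j → toℕ j ≡ suc (toℕ i) → A i j * A j i ≈ w (toℕ i)

  open IsTridiagonal

  shift-isTridiagonal : ∀ {x w} {A : Matrix Carrier (suc n)} →
                        IsTridiagonal x w A → IsTridiagonal x (w ∘ suc) (shift A)
  shift-isTridiagonal t = record
    { diagonal = diagonal t ∘ fsuc
    ; upper    = λ i j → upper t (fsuc i) (fsuc j) ∘ s≤s
    ; lower    = λ i j → lower t (fsuc i) (fsuc j) ∘ s≤s
    ; product  = λ i j → product t (fsuc i) (fsuc j) ∘ ≡.cong suc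
    }

  -- Euler's continuant with partial numerators `- w i`. The weight `w i` belongs to the pair of
  -- indices i and i + 1, so removing the first index shifts the weights.
  continuant : Carrier → (ℕ → Carrier) → ℕ → Carrier
  continuant x w 0             = 1#
  continuant x w 1             = x
  continuant x w (suc (suc n)) =
    x * continuant x (w ∘ suc) (suc n) - w 0 * continuant x (w ∘ suc ∘ suc) n

  det-tridiagonal : ∀ {x w} {A : Matrix Carrier n} → IsTridiagonal x w A → det A ≈ continuant x w n
  det-tridiagonal {zero} t = refl
  det-tridiagonal {suc zero} {x} {A = A} t = begin
    1# * A fzero fzero * 1# + 0#  ≈⟨ +-identityʳ _ ⟩
    1# * A fzero fzero * 1#       ≈⟨ *-identityʳ _ ⟩
    1# * A fzero fzero            ≈⟨ *-identityˡ _ ⟩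
    A fzero fzero                 ≈⟨ diagonal t fzero ⟩
    x                             ∎
  det-tridiagonal {suc (suc n)} {A = A} t = trans
    (det-expand A (λ j → upper t fzero (fsuc (fsuc j)) (s≤s (s≤s z≤n)))
                  (λ i → lower t (fsuc (fsuc i)) fzero (s≤s (s≤s z≤n))))
    (+-cong (*-cong (diagonal t fzero) (det-tridiagonal (shift-isTridiagonal t)))
            (-‿cong (*-cong (product t fzero (fsuc fzero) ≡.refl)
                            (det-tridiagonal (shift-isTridiagonal (shift-isTridiagonal t))))))

  -- In the application `x`, `q`, `h`, `L` are λ, ¼, ½ and `Λ`.
  module PathContinuant (x q h : Carrier) (L : ℕ → Carrier)
    (L₀ : L 0 ≈ 1#) (L₁ : L 1 ≈ x) (L-rec : ∀ k → L (suc (suc k)) ≈ x * L (suc k) - q * L k)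
    (h+h≈1 : h + h ≈ 1#) (h*h≈q : h * h ≈ q) where

    open SemiringSolver commutativeSemiring using (solve; _:+_; _:*_; _:=_)

    -- The solver works in commutative semirings, so minus signs are moved into the coefficients
    -- `- q` and `- h`, which it then treats as atoms.
    L-rec⁺ : ∀ k → L (suc (suc k)) ≈ x * L (suc k) + - q * L k
    L-rec⁺ k = trans (L-rec k) (+-congˡ (-‿distribˡ-* q _))

    step : ∀ {v r K a K′ b} → v ≈ r → K ≈ a → K′ ≈ b → x * K - v * K′ ≈ x * a + - r * b
    step v≈r K≈a K′≈b =
      +-cong (*-congˡ K≈a) (trans (-‿distribˡ-* _ _) (*-cong (-‿cong v≈r) K′≈b))

    -- Both sides satisfy the recurrence of L in m.
    continuant-tail : ∀ m w → (∀ i → i ℕ.< m → w i ≈ q) → w m ≈ h →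
                      continuant x w (suc (suc m)) ≈ x * L (suc m) + - h * L m
    continuant-tail 0 w w≈q w≈h = step w≈h (sym L₁) (sym L₀)
    -- Two vertices fewer leave a path of length 1, which is too short for the statement; its
    -- continuant is `x`, that is, `L 1`.
    continuant-tail 1 w w≈q w≈h = begin
      continuant x w 3
        ≈⟨ step (w≈q 0 (s≤s z≤n)) (continuant-tail 0 (w ∘ suc) (λ _ ()) w≈h) (sym L₁) ⟩
      x * (x * L 1 + - h * L 0) + - q * L 1
        ≈⟨ +-cong (*-congˡ (+-congˡ (trans (*-congˡ L₀) (*-identityʳ _)))) (*-congˡ L₁) ⟩
      x * (x * L 1 + - h) + - q * x
        ≈⟨ solve 4 (λ x a h q → x :* (x :* a :+ h) :+ q :* x := x :* (x :* a :+ q) :+ h :* x)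
                 refl x (L 1) (- h) (- q) ⟩
      x * (x * L 1 + - q) + - h * x
        ≈⟨ +-cong (*-congˡ (+-congˡ (trans (*-congˡ L₀) (*-identityʳ _)))) (*-congˡ L₁) ⟨
      x * (x * L 1 + - q * L 0) + - h * L 1
        ≈⟨ +-congʳ (*-congˡ (L-rec⁺ 0)) ⟨
      x * L 2 + - h * L 1 ∎
    continuant-tail (suc (suc m)) w w≈q w≈h = begin
      continuant x w (suc (suc (suc (suc m))))
        ≈⟨ step (w≈q 0 (s≤s z≤n)) (continuant-tail (suc m) (w ∘ suc) (λ i → w≈q (suc i) ∘ s≤s) w≈h)
                (continuant-tail m (w ∘ suc ∘ suc) (λ i → w≈q (suc (suc i)) ∘ s≤s ∘ s≤s) w≈h) ⟩
      x * (x * L (suc (suc m)) + - h * L (suc m)) + - q * (x * L (suc m) + - h * L m)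
        ≈⟨ solve 6 (λ x q h a b c → x :* (x :* a :+ h :* b) :+ q :* (x :* b :+ h :* c)
                                  := x :* (x :* a :+ q :* b) :+ h :* (x :* b :+ q :* c))
                 refl x (- q) (- h) (L (suc (suc m))) (L (suc m)) (L m) ⟩
      x * (x * L (suc (suc m)) + - q * L (suc m)) + - h * (x * L (suc m) + - q * L m)
        ≈⟨ +-cong (*-congˡ (L-rec⁺ (suc m))) (*-congˡ (L-rec⁺ m)) ⟨
      x * L (suc (suc (suc m))) + - h * L (suc (suc m)) ∎

    continuant-path : ∀ m w → w 0 ≈ h → (∀ i → i ℕ.< suc m → w (suc i) ≈ q) → w (suc (suc m)) ≈ h →
                      continuant x w (suc (suc (suc (suc m)))) ≈
                      (x * x - 1#) * (x * L (suc m) - q * L m)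
    continuant-path m w w₀≈h w≈q w≈h = begin
      continuant x w (suc (suc (suc (suc m))))
        -- Without the left end edge, both remaining continuants have `h` at their right end only.
        ≈⟨ step w₀≈h (continuant-tail (suc m) (w ∘ suc) w≈q w≈h)
                (continuant-tail m (w ∘ suc ∘ suc) (λ i → w≈q (suc i) ∘ s≤s) w≈h) ⟩
      x * (x * L (suc (suc m)) + - h * L (suc m)) + - h * (x * L (suc m) + - h * L m)
        ≈⟨ solve 5 (λ x h a b c → x :* (x :* a :+ h :* b) :+ h :* (x :* b :+ h :* c)
                                := x :* x :* a :+ ((h :+ h) :* (x :* b) :+ h :* h :* c))
                 refl x (- h) (L (suc (suc m))) (L (suc m)) (L m) ⟩
      x * x * L (suc (suc m)) + ((- h + - h) * (x * L (suc m)) + - h * - h * L m)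
        ≈⟨ +-cong (*-congˡ (L-rec⁺ m)) (+-cong (*-congʳ -h-h≈-1) (*-congʳ -h*-h≈-1*-q)) ⟩
      x * x * (x * L (suc m) + - q * L m) + (- 1# * (x * L (suc m)) + - 1# * - q * L m)
        ≈⟨ solve 5 (λ x u q b c → x :* x :* (x :* b :+ q :* c) :+ (u :* (x :* b) :+ u :* q :* c)
                                := (x :* x :+ u) :* (x :* b :+ q :* c))
                 refl x (- 1#) (- q) (L (suc m)) (L m) ⟩
      (x * x - 1#) * (x * L (suc m) + - q * L m)
        ≈⟨ *-congˡ (+-congˡ (-‿distribˡ-* q _)) ⟨
      (x * x - 1#) * (x * L (suc m) - q * L m) ∎
      where
      -h-h≈-1 : - h + - h ≈ - 1#
      -h-h≈-1 = trans (-‿+-comm h h) (-‿cong h+h≈1)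
      -- The right side is not simplified to `q`: the solver cannot relate `q` to `- q`, but it can
      -- factor out the common atom `- 1#`.
      -h*-h≈-1*-q : - h * - h ≈ - 1# * - q
      -h*-h≈-1*-q = begin
        - h * - h    ≈⟨ -‿distribˡ-* h (- h) ⟨
        - (h * - h)  ≈⟨ -‿cong (-‿distribʳ-* h h) ⟨
        - - (h * h)  ≈⟨ -‿cong (-‿cong h*h≈q) ⟩
        - - q        ≈⟨ -1*x≈-x (- q) ⟨
        - 1# * - q   ∎

-- Polynomials over a commutative ring

module PolynomialRing (R : CommutativeRing c ℓ) where
  open CommutativeRing R
  open Polynomial rawRing using (Poly; coeff; _≈ₚ_; _+ₚ_; _*ₚ_)
  open RingProperties ring using (-0#≈0#)

  -- _≈ₚ_ unfolds to a function type from which the two polynomials cannot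
  -- be inferred, hence the wrapper.
  infix 4 _≋_
  record _≋_ (p q : Poly) : Set ℓ where
    constructor coeffwise
    field at : p ≈ₚ q
  open _≋_

  infixr 7 _·_
  _·_ : Carrier → Poly → Poly
  a · p = map (a *_) p

  coeff-+ : ∀ p q k → coeff (p +ₚ q) k ≈ coeff p k + coeff q k
  coeff-+ []      q       k       = sym (+-identityˡ _)
  coeff-+ (a ∷ p) []      k       = sym (+-identityʳ _)
  coeff-+ (a ∷ p) (b ∷ q) zero    = refl
  coeff-+ (a ∷ p) (b ∷ q) (suc k) = coeff-+ p q k

  coeff-· : ∀ a p k → coeff (a · p) k ≈ a * coeff p k
  coeff-· a []      k       = sym (zeroʳ a)
  coeff-· a (b ∷ p) zero    = refl
  coeff-· a (b ∷ p) (suc k) = coeff-· a p k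

  coeff-neg : ∀ p k → coeff (map (-_) p) k ≈ - coeff p k
  coeff-neg []      k       = sym -0#≈0#
  coeff-neg (a ∷ p) zero    = refl
  coeff-neg (a ∷ p) (suc k) = coeff-neg p k

  +ₚ-cong : ∀ {p p′ q q′} → p ≋ p′ → q ≋ q′ → p +ₚ q ≋ p′ +ₚ q′
  +ₚ-cong {p} {p′} {q} {q′} p≋p′ q≋q′ .at k =
    trans (coeff-+ p q k) (trans (+-cong (at p≋p′ k) (at q≋q′ k)) (sym (coeff-+ p′ q′ k)))

  +ₚ-assoc : ∀ p q r → (p +ₚ q) +ₚ r ≋ p +ₚ (q +ₚ r)
  +ₚ-assoc p q r .at k = begin
    coeff ((p +ₚ q) +ₚ r) k              ≈⟨ coeff-+ (p +ₚ q) r k ⟩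
    coeff (p +ₚ q) k + coeff r k         ≈⟨ +-congʳ (coeff-+ p q k) ⟩
    coeff p k + coeff q k + coeff r k    ≈⟨ +-assoc _ _ _ ⟩
    coeff p k + (coeff q k + coeff r k)  ≈⟨ +-congˡ (coeff-+ q r k) ⟨
    coeff p k + coeff (q +ₚ r) k         ≈⟨ coeff-+ p (q +ₚ r) k ⟨
    coeff (p +ₚ (q +ₚ r)) k              ∎
    where open SetoidReasoning setoid

  +ₚ-comm : ∀ p q → p +ₚ q ≋ q +ₚ p
  +ₚ-comm p q .at k = trans (coeff-+ p q k) (trans (+-comm _ _) (sym (coeff-+ q p k)))

  neg-cong : ∀ {p q} → p ≋ q → map (-_) p ≋ map (-_) q
  neg-cong {p} {q} p≋q .at k =
    trans (coeff-neg p k) (trans (-‿cong (at p≋q k)) (sym (coeff-neg q k)))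

  neg-inverseʳ : ∀ p → p +ₚ map (-_) p ≋ []
  neg-inverseʳ p .at k =
    trans (coeff-+ p (map (-_) p) k) (trans (+-congˡ (coeff-neg p k)) (-‿inverseʳ _))

  ·-congˡ : ∀ {a p q} → p ≋ q → a · p ≋ a · q
  ·-congˡ {a} {p} {q} p≋q .at k =
    trans (coeff-· a p k) (trans (*-congˡ (at p≋q k)) (sym (coeff-· a q k)))

  0·-zero : ∀ p → 0# · p ≋ []
  0·-zero p .at k = trans (coeff-· 0# p k) (zeroˡ _)

  1·-identity : ∀ p → 1# · p ≋ p
  1·-identity p .at k = trans (coeff-· 1# p k) (*-identityˡ _)

  ∷-cong : ∀ {a b p q} → a ≈ b → p ≋ q → a ∷ p ≋ b ∷ q
  ∷-cong a≈b p≋q .at zero    = a≈b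
  ∷-cong a≈b p≋q .at (suc k) = at p≋q k

  [0]-zero : 0# ∷ [] ≋ []
  [0]-zero .at zero    = refl
  [0]-zero .at (suc k) = refl

  +ₚ-abelianGroup : AbelianGroup c ℓ
  +ₚ-abelianGroup = record
    { _≈_            = _≋_
    ; _∙_            = _+ₚ_
    ; ε              = []
    ; _⁻¹            = map (-_)
    ; isAbelianGroup = record
      { isGroup = record
        { isMonoid = record
          { isSemigroup = record
            { isMagma = record
              { isEquivalence = record
                { refl  = coeffwise λ k → refl
                ; sym   = λ p≋q → coeffwise λ k → sym (at p≋q k)
                ; trans = λ p≋q q≋r → coeffwise λ k → trans (at p≋q k) (at q≋r k)
                }
              ; ∙-cong = +ₚ-cong
              }
            ; assoc = +ₚ-assoc
            }
          ; identity = (λ p → coeffwise λ k → refl) , (λ p → coeffwise λ k → at (+ₚ-comm p []) k)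
          }
        ; inverse = (λ p → coeffwise λ k → trans (at (+ₚ-comm (map (-_) p) p) k) (at (neg-inverseʳ p) k))
                  , neg-inverseʳ
        ; ⁻¹-cong = neg-cong
        }
      ; comm = +ₚ-comm
      }
    }

  private
    module P = AbelianGroup +ₚ-abelianGroup
  open SetoidReasoning P.setoid
  open CommutativeSemigroupProperties (CommutativeMonoid.commutativeSemigroup P.commutativeMonoid)
    using (x∙yz≈y∙xz; interchange)

  ·-assoc : ∀ a b p → (a * b) · p ≋ a · b · p
  ·-assoc a b []      = P.refl
  ·-assoc a b (c ∷ p) = ∷-cong (*-assoc a b c) (·-assoc a b p)

  ·-distribˡ-+ₚ : ∀ a p q → a · (p +ₚ q) ≋ a · p +ₚ a · q
  ·-distribˡ-+ₚ a []      q       = P.refl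
  ·-distribˡ-+ₚ a (b ∷ p) []      = P.refl
  ·-distribˡ-+ₚ a (b ∷ p) (c ∷ q) = ∷-cong (distribˡ a b c) (·-distribˡ-+ₚ a p q)

  *ₚ-congˡ : ∀ p {q q′} → q ≋ q′ → p *ₚ q ≋ p *ₚ q′
  *ₚ-congˡ []      q≋q′ = P.refl
  *ₚ-congˡ (a ∷ p) q≋q′ =
    +ₚ-cong (·-congˡ q≋q′) (∷-cong refl (*ₚ-congˡ p q≋q′))

  *ₚ-zeroʳ : ∀ p → p *ₚ [] ≋ []
  *ₚ-zeroʳ []      = P.refl
  *ₚ-zeroʳ (a ∷ p) = P.trans (∷-cong refl (*ₚ-zeroʳ p)) [0]-zero

  -- The mirror image of the defining clause of `_*ₚ_`, which splits only its left factor; the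
  -- induction for commutativity needs both.
  *ₚ-∷ : ∀ p b q → p *ₚ (b ∷ q) ≋ b · p +ₚ (0# ∷ p *ₚ q)
  *ₚ-∷ []      b q = P.sym [0]-zero
  *ₚ-∷ (a ∷ p) b q = ∷-cong (+-congʳ (*-comm a b)) (begin
    a · q +ₚ p *ₚ (b ∷ q)               ≈⟨ P.∙-congˡ (*ₚ-∷ p b q) ⟩
    a · q +ₚ (b · p +ₚ (0# ∷ p *ₚ q))   ≈⟨ x∙yz≈y∙xz (a · q) (b · p) (0# ∷ p *ₚ q) ⟩
    b · p +ₚ (a · q +ₚ (0# ∷ p *ₚ q))   ∎)

  *ₚ-comm : ∀ p q → p *ₚ q ≋ q *ₚ p
  *ₚ-comm []      q = P.sym (*ₚ-zeroʳ q)
  *ₚ-comm (a ∷ p) q = begin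
    a · q +ₚ (0# ∷ p *ₚ q)  ≈⟨ P.∙-congˡ (∷-cong refl (*ₚ-comm p q)) ⟩
    a · q +ₚ (0# ∷ q *ₚ p)  ≈⟨ *ₚ-∷ q a p ⟨
    q *ₚ (a ∷ p)            ∎

  -- Equal polynomials can be lists of different lengths, so a direct induction on the left factors
  -- would have to treat trailing zeros. Commutativity reduces the claim to a fixed left factor.
  *ₚ-congʳ : ∀ q {p p′} → p ≋ p′ → p *ₚ q ≋ p′ *ₚ q
  *ₚ-congʳ q {p} {p′} p≋p′ = begin
    p *ₚ q   ≈⟨ *ₚ-comm p q ⟩
    q *ₚ p   ≈⟨ *ₚ-congˡ q p≋p′ ⟩
    q *ₚ p′  ≈⟨ *ₚ-comm q p′ ⟩
    p′ *ₚ q  ∎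

  *ₚ-distribˡ-+ₚ : ∀ p q r → p *ₚ (q +ₚ r) ≋ p *ₚ q +ₚ p *ₚ r
  *ₚ-distribˡ-+ₚ []      q r = P.refl
  *ₚ-distribˡ-+ₚ (a ∷ p) q r = begin
    a · (q +ₚ r) +ₚ (0# ∷ p *ₚ (q +ₚ r))
      ≈⟨ P.∙-cong (·-distribˡ-+ₚ a q r)
                  (∷-cong (sym (+-identityˡ 0#)) (*ₚ-distribˡ-+ₚ p q r)) ⟩
    (a · q +ₚ a · r) +ₚ ((0# ∷ p *ₚ q) +ₚ (0# ∷ p *ₚ r))
      ≈⟨ interchange (a · q) (a · r) (0# ∷ p *ₚ q) (0# ∷ p *ₚ r) ⟩
    (a · q +ₚ (0# ∷ p *ₚ q)) +ₚ (a · r +ₚ (0# ∷ p *ₚ r)) ∎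

  *ₚ-distribʳ-+ₚ : ∀ r p q → (p +ₚ q) *ₚ r ≋ p *ₚ r +ₚ q *ₚ r
  *ₚ-distribʳ-+ₚ r p q = begin
    (p +ₚ q) *ₚ r       ≈⟨ *ₚ-comm (p +ₚ q) r ⟩
    r *ₚ (p +ₚ q)       ≈⟨ *ₚ-distribˡ-+ₚ r p q ⟩
    r *ₚ p +ₚ r *ₚ q    ≈⟨ P.∙-cong (*ₚ-comm r p) (*ₚ-comm r q) ⟩
    p *ₚ r +ₚ q *ₚ r    ∎

  ·-*ₚ-assoc : ∀ a p q → (a · p) *ₚ q ≋ a · (p *ₚ q)
  ·-*ₚ-assoc a []      q = P.refl
  ·-*ₚ-assoc a (b ∷ p) q = begin
    (a * b) · q +ₚ (0# ∷ (a · p) *ₚ q)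
      ≈⟨ P.∙-cong (·-assoc a b q) (∷-cong (sym (zeroʳ a)) (·-*ₚ-assoc a p q)) ⟩
    a · b · q +ₚ a · (0# ∷ p *ₚ q)
      ≈⟨ ·-distribˡ-+ₚ a (b · q) (0# ∷ p *ₚ q) ⟨
    a · (b · q +ₚ (0# ∷ p *ₚ q)) ∎

  0∷-*ₚ : ∀ p q → (0# ∷ p) *ₚ q ≋ 0# ∷ p *ₚ q
  0∷-*ₚ p q = P.∙-congʳ (0·-zero q)

  *ₚ-assoc : ∀ p q r → (p *ₚ q) *ₚ r ≋ p *ₚ (q *ₚ r)
  *ₚ-assoc []      q r = P.refl
  *ₚ-assoc (a ∷ p) q r = begin
    (a · q +ₚ (0# ∷ p *ₚ q)) *ₚ r
      ≈⟨ *ₚ-distribʳ-+ₚ r (a · q) (0# ∷ p *ₚ q) ⟩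
    (a · q) *ₚ r +ₚ (0# ∷ p *ₚ q) *ₚ r
      ≈⟨ P.∙-cong (·-*ₚ-assoc a q r)
           (P.trans (0∷-*ₚ (p *ₚ q) r) (∷-cong refl (*ₚ-assoc p q r))) ⟩
    a · (q *ₚ r) +ₚ (0# ∷ p *ₚ (q *ₚ r)) ∎

  *ₚ-identityˡ : ∀ p → [ 1# ] *ₚ p ≋ p
  *ₚ-identityˡ p = begin
    1# · p +ₚ (0# ∷ [])  ≈⟨ P.∙-cong (1·-identity p) [0]-zero ⟩
    p +ₚ []              ≈⟨ P.identityʳ p ⟩
    p                    ∎

  const-cong : ∀ {a b} → a ≈ b → [ a ] ≈ₚ [ b ]
  const-cong a≈b = at (∷-cong a≈b P.refl)

  const-* : ∀ a b → [ a ] *ₚ [ b ] ≈ₚ [ a * b ]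
  const-* a b = at (∷-cong (+-identityʳ (a * b)) P.refl)

  polynomialRing : CommutativeRing c ℓ
  polynomialRing = record
    { Carrier           = Poly
    ; _≈_               = _≈ₚ_
    ; _+_               = _+ₚ_
    ; _*_               = _*ₚ_
    ; -_                = map (-_)
    ; 0#                = []
    ; 1#                = [ 1# ]
    ; isCommutativeRing = record
      { isRing = record
        { +-isAbelianGroup = record
          { isGroup = record
            { isMonoid = record
              { isSemigroup = record
                { isMagma = record
                  { isEquivalence = record
                    { refl  = λ k → refl
                    ; sym   = λ p≈q k → sym (p≈q k)
                    ; trans = λ p≈q q≈r k → trans (p≈q k) (q≈r k)
                    }
                  ; ∙-cong = λ {p} {p′} {q} {q′} p≈p′ q≈q′ →
                      at (+ₚ-cong {p} {p′} {q} {q′} (coeffwise p≈p′) (coeffwise q≈q′))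
                  }
                ; assoc = λ p q r → at (+ₚ-assoc p q r)
                }
              ; identity = (λ p → at (P.identityˡ p)) , (λ p → at (P.identityʳ p))
              }
            ; inverse = (λ p → at (P.inverseˡ p)) , (λ p → at (P.inverseʳ p))
            ; ⁻¹-cong = λ {p} {q} p≈q → at (neg-cong {p} {q} (coeffwise p≈q))
            }
          ; comm = λ p q → at (+ₚ-comm p q)
          }
        ; *-cong     = λ {p} {p′} {q} {q′} p≈p′ q≈q′ →
            at (P.trans (*ₚ-congʳ q {p} {p′} (coeffwise p≈p′)) (*ₚ-congˡ p′ {q} {q′} (coeffwise q≈q′)))
        ; *-assoc    = λ p q r → at (*ₚ-assoc p q r)
        ; *-identity = (λ p → at (*ₚ-identityˡ p))
                     , (λ p → at (P.trans (*ₚ-comm p [ 1# ]) (*ₚ-identityˡ p)))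
        ; distrib    = (λ p q r → at (*ₚ-distribˡ-+ₚ p q r)) , (λ p q r → at (*ₚ-distribʳ-+ₚ p q r))
        }
      ; *-comm = λ p q → at (*ₚ-comm p q)
      }
    }

-- The characteristic matrix of a tridiagonal matrix

module CharacteristicMatrix (R : CommutativeRing c ℓ) where
  private
    module R = CommutativeRing R
    module PR = PolynomialRing R
    module P = CommutativeRing PR.polynomialRing
    module RT = TridiagonalDeterminant R
    module PT = TridiagonalDeterminant PR.polynomialRing
  open Polynomial R.rawRing using (Poly; X; _≈ₚ_) renaming (const to constₚ)
  open Determinant P.rawRing using (identity)
  open RingProperties R.ring using (-0#≈0#; -‿distribˡ-*; -‿distribʳ-*; -‿involutive)

  characteristicMatrix : Matrix R.Carrier n → Matrix Poly n
  characteristicMatrix A i j = X P.* identity i j P.+ P.- constₚ (A i j)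

  diagonal-entry : (A : Matrix R.Carrier n) → ∀ i → A i i R.≈ R.0# → characteristicMatrix A i i ≈ₚ X
  diagonal-entry A i Aii≈0 rewrite dec-true (i Fin.≟ i) ≡.refl = λ where
    zero          → R.trans
      (R.+-cong (R.trans (R.+-identityʳ _) (R.zeroˡ _)) (R.trans (R.-‿cong Aii≈0) -0#≈0#))
      (R.+-identityˡ _)
    (suc zero)    → R.trans (R.+-identityʳ _) (R.*-identityˡ _)
    (suc (suc k)) → R.refl

  offDiagonal-entry : (A : Matrix R.Carrier n) → ∀ {i j} → i ≢ j →
                      characteristicMatrix A i j ≈ₚ constₚ (R.- A i j)
  offDiagonal-entry A {i} {j} i≢j rewrite dec-false (i Fin.≟ j) i≢j = λ where
    zero          → R.+-identityˡ _
    (suc zero)    → R.refl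
    (suc (suc k)) → R.refl

  zero-entry : (A : Matrix R.Carrier n) → ∀ {i j} → i ≢ j → A i j R.≈ R.0# →
               characteristicMatrix A i j ≈ₚ []
  zero-entry A i≢j Aij≈0 k = R.trans (offDiagonal-entry A i≢j k) (vanish k)
    where
    vanish : constₚ (R.- A _ _) ≈ₚ []
    vanish zero    = R.trans (R.-‿cong Aij≈0) -0#≈0#
    vanish (suc k) = R.refl

  -- Off the diagonal the entries of λI - A are negated constants, and the two signs cancel in the
  -- product. Hence A and λI - A have the same weights.
  product-entry : (A : Matrix R.Carrier n) → ∀ {i j a} → i ≢ j → A i j R.* A j i R.≈ a →
                  (characteristicMatrix A i j P.* characteristicMatrix A j i) ≈ₚ constₚ a
  product-entry A {i} {j} {a} i≢j AA≈a k = R.trans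
    (P.*-cong {characteristicMatrix A i j} {constₚ (R.- A i j)} {characteristicMatrix A j i} {constₚ (R.- A j i)}
      (offDiagonal-entry A i≢j) (offDiagonal-entry A (i≢j ∘ ≡.sym)) k)
    (R.trans (PR.const-* (R.- A i j) (R.- A j i) k) (PR.const-cong signs k))
    where
    open SetoidReasoning R.setoid
    signs : R.- A i j R.* R.- A j i R.≈ a
    signs = begin
      R.- A i j R.* R.- A j i      ≈⟨ -‿distribˡ-* _ _ ⟨
      R.- (A i j R.* R.- A j i)    ≈⟨ R.-‿cong (-‿distribʳ-* _ _) ⟨
      R.- (R.- (A i j R.* A j i))  ≈⟨ -‿involutive _ ⟩
      A i j R.* A j i              ≈⟨ AA≈a ⟩
      a                            ∎

  characteristicMatrix-isTridiagonal : ∀ {w} {A : Matrix R.Carrier n} →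
    RT.IsTridiagonal R.0# w A → PT.IsTridiagonal X (constₚ ∘ w) (characteristicMatrix A)
  characteristicMatrix-isTridiagonal {A = A} t = record
    { diagonal = λ i → diagonal-entry A i (diagonal i)
    ; upper    = λ i j 2+i≤j → zero-entry A (λ { ≡.refl → ℕₚ.<-asym (ℕₚ.n<1+n _) 2+i≤j }) (upper i j 2+i≤j)
    ; lower    = λ i j 2+j≤i → zero-entry A (λ { ≡.refl → ℕₚ.<-asym (ℕₚ.n<1+n _) 2+j≤i }) (lower i j 2+j≤i)
    ; product  = λ i j j≡1+i → product-entry A (λ { ≡.refl → ℕₚ.1+n≢n (≡.sym j≡1+i) }) (product i j j≡1+i)
    }
    where
    open RT.IsTridiagonal t

-- The ring is a raw ring with its laws, so that an instance speaks of exactly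
-- the operations of that raw ring: at the reals, conversion checking would
-- otherwise unfold the proofs of the Cauchy property.
module CharacteristicPolynomial (R : RawRing c ℓ) (isCommutativeRing : HasCommutativeRingLaws R) where
  private
    RR = commutativeRing R isCommutativeRing
    PR = PolynomialRing.polynomialRing RR
    module P = CommutativeRing PR
    module Pᵣ = RawRing (Polynomial.rawRing R)
    module R = CommutativeRing RR
  open RawRing R using (Carrier) renaming (_≈_ to _≈ᵣ_; _+_ to _+ᵣ_; _*_ to _*ᵣ_; 0# to 0ᵣ; 1# to 1ᵣ)
  open Polynomial R using (Poly; X; _≈ₚ_; _+ₚ_; _*ₚ_) renaming (const to constₚ)
  open Determinant (Polynomial.rawRing R) using (det; identity)
  open TridiagonalDeterminant RR using (IsTridiagonal)
  open TridiagonalDeterminant PR using (det-tridiagonal; module PathContinuant)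
  open CharacteristicMatrix RR
  open PolynomialRing RR using (const-cong; const-*)

  characteristicPolynomial-path : ∀ {q h} (w : ℕ → Carrier) → (h +ᵣ h) ≈ᵣ 1ᵣ → (h *ᵣ h) ≈ᵣ q →
    (L : ℕ → Poly) → L 0 ≈ₚ Pᵣ.1# → L 1 ≈ₚ X → L 2 ≈ₚ X *ₚ X +ₚ Pᵣ.- constₚ q →
    (∀ k → L (suc (suc (suc k))) ≈ₚ X *ₚ L (suc (suc k)) +ₚ Pᵣ.- (constₚ q *ₚ L (suc k))) →
    ∀ n → 4 ≤ n → {A : Matrix Carrier n} → IsTridiagonal 0ᵣ w A →
    w 0 ≈ᵣ h → (∀ i → i ℕ.< n ∸ 3 → w (suc i) ≈ᵣ q) → w (suc (n ∸ 3)) ≈ᵣ h →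
    det (λ i j → X *ₚ identity i j +ₚ Pᵣ.- constₚ (A i j)) ≈ₚ
    (X *ₚ X +ₚ Pᵣ.- Pᵣ.1#) *ₚ (X *ₚ L (n ∸ 3) +ₚ Pᵣ.- (constₚ q *ₚ L (n ∸ 4)))
  characteristicPolynomial-path {q} {h} w h+h≈1 h*h≈q L L₀ L₁ L₂ L-step
    (suc (suc (suc (suc m)))) (s≤s (s≤s (s≤s (s≤s z≤n)))) t w₀≈h w≈q w≈h k = R.trans
    (det-tridiagonal (characteristicMatrix-isTridiagonal t) k)
    (continuant-path m (constₚ ∘ w) (const-cong w₀≈h) (λ i → const-cong ∘ w≈q i) (const-cong w≈h) k)
    where
    L-rec : ∀ k → L (suc (suc k)) ≈ₚ X *ₚ L (suc k) +ₚ Pᵣ.- (constₚ q *ₚ L k)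
    L-rec (suc k) = L-step k
    -- The formula for `L 2` has `q` where the recurrence has `q` times `L 0`; these agree because
    -- `L 0` is 1.
    L-rec zero    = P.trans {L 2} {X *ₚ X +ₚ Pᵣ.- constₚ q} {X *ₚ L 1 +ₚ Pᵣ.- (constₚ q *ₚ L 0)} L₂
      (P.+-cong {X *ₚ X} {X *ₚ L 1} {Pᵣ.- constₚ q} {Pᵣ.- (constₚ q *ₚ L 0)}
        (P.*-congˡ {X} {X} {L 1} (P.sym {L 1} {X} L₁))
        (P.-‿cong {constₚ q} {constₚ q *ₚ L 0}
          (P.trans {constₚ q} {constₚ q *ₚ Pᵣ.1#} {constₚ q *ₚ L 0}
            (P.sym {constₚ q *ₚ Pᵣ.1#} {constₚ q} (P.*-identityʳ (constₚ q)))
            (P.*-congˡ {constₚ q} {Pᵣ.1#} {L 0} (P.sym {L 0} {Pᵣ.1#} L₀)))))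
    open PathContinuant X (constₚ q) (constₚ h) L L₀ L₁ L-rec (const-cong h+h≈1)
      (P.trans {constₚ h *ₚ constₚ h} {constₚ (h *ᵣ h)} {constₚ q}
        (const-* h h) (const-cong h*h≈q))

-- The ring of real numbers and square roots

open ℚ-Lemmas
open √-Lemmas

-- By definition `x ≈ℝ y` says that the difference of the two sequences is null, so laws of equality
-- become closure properties of null sequences.
Null : (ℕ → ℚ) → Set
Null s = ∀ ε → 0ℚ ℚ.< ε → ∃ λ N → ∀ n → N ℕ.≤ n → ℚ.∣ s n ∣ ℚ.≤ ε

null-resp-≗ : ∀ {s t} → (∀ n → s n ≡ t n) → Null s → Null t
null-resp-≗ s≗t null ε 0<ε with N , small ← null ε 0<ε =
  N , λ n N≤n → ≡.subst (λ q → ℚ.∣ q ∣ ℚ.≤ ε) (s≗t n) (small n N≤n)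

null-0 : ∀ {s} → (∀ n → s n ≡ 0ℚ) → Null s
null-0 s≗0 ε 0<ε = 0 , λ n _ → ≡.subst (λ q → ℚ.∣ q ∣ ℚ.≤ ε) (≡.sym (s≗0 n)) (ℚₚ.<⇒≤ 0<ε)

null-neg : ∀ {s} → Null s → Null (λ n → ℚ.- s n)
null-neg {s} null ε 0<ε with N , small ← null ε 0<ε =
  N , λ n N≤n → ≡.subst (ℚ._≤ ε) (≡.sym (ℚₚ.∣-p∣≡∣p∣ (s n))) (small n N≤n)

null-+ : ∀ {s t} → Null s → Null t → Null (λ n → s n ℚ.+ t n)
null-+ {s} {t} null-s null-t ε 0<ε
  with M , small-s ← null-s (½ ℚ.* ε) (0<* 0<½ 0<ε)
     | N , small-t ← null-t (½ ℚ.* ε) (0<* 0<½ 0<ε) = M ℕ.⊔ N , λ n h → begin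
  ℚ.∣ s n ℚ.+ t n ∣          ≤⟨ ℚₚ.∣p+q∣≤∣p∣+∣q∣ (s n) (t n) ⟩
  ℚ.∣ s n ∣ ℚ.+ ℚ.∣ t n ∣    ≤⟨ ℚₚ.+-mono-≤ (small-s n (ℕₚ.m⊔n≤o⇒m≤o M N h)) (small-t n (ℕₚ.m⊔n≤o⇒n≤o M N h)) ⟩
  ½ ℚ.* ε ℚ.+ ½ ℚ.* ε        ≡⟨ ℚₚ.*-distribʳ-+ ε ½ ½ ⟨
  1ℚ ℚ.* ε                   ≡⟨ ℚₚ.*-identityˡ ε ⟩
  ε                          ∎
  where open ℚₚ.≤-Reasoning

null-* : ∀ {s t} → EventuallyBounded s → Null t → Null (λ n → s n ℚ.* t n)
null-* {s} {t} (B , 0<B , M , bound) null ε 0<ε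
  with δ , 0<δ , Bδ≡ε ← divide 0<B 0<ε
  with N , small ← null δ 0<δ = M ℕ.⊔ N , λ n h → begin
  ℚ.∣ s n ℚ.* t n ∣        ≡⟨ ℚₚ.∣p*q∣≡∣p∣*∣q∣ (s n) (t n) ⟩
  ℚ.∣ s n ∣ ℚ.* ℚ.∣ t n ∣  ≤⟨ *-mono (ℚₚ.0≤∣p∣ (t n)) (ℚₚ.<⇒≤ 0<B) (bound n (ℕₚ.m⊔n≤o⇒m≤o M N h)) (small n (ℕₚ.m⊔n≤o⇒n≤o M N h)) ⟩
  B ℚ.* δ                  ≡⟨ Bδ≡ε ⟩
  ε                        ∎
  where open ℚₚ.≤-Reasoning

private
  module ℝᵣ = RawRing ℝ-rawRing

-- The ring operations act term by term, so the equational ring laws are inherited from ℚ at every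
-- index. Estimates enter only through transitivity and the congruences.
pointwise : ∀ x y → (∀ n → seq x n ≡ seq y n) → x ≈ℝ y
pointwise x y x≗y = null-0 λ n →
  ≡.trans (≡.cong (ℚ._- seq y n) (x≗y n)) (ℚₚ.+-inverseʳ (seq y n))

≈ℝ-sym : ∀ x y → x ≈ℝ y → y ≈ℝ x
≈ℝ-sym x y x≈y = null-resp-≗ (λ n → neg-difference (seq x n) (seq y n)) (null-neg x≈y)

≈ℝ-trans : ∀ x y z → x ≈ℝ y → y ≈ℝ z → x ≈ℝ z
≈ℝ-trans x y z x≈y y≈z =
  null-resp-≗ (λ n → telescope (seq x n) (seq y n) (seq z n)) (null-+ x≈y y≈z)
  where
  open ℚ-Solver
  telescope : ∀ a b c → (a ℚ.- b) ℚ.+ (b ℚ.- c) ≡ a ℚ.- c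
  telescope = solve 3 (λ a b c → (a :- b) :+ (b :- c) := a :- c) ≡.refl

+ℝ-cong : ∀ x x′ y y′ → x ≈ℝ x′ → y ≈ℝ y′ → (x ℝᵣ.+ y) ≈ℝ (x′ ℝᵣ.+ y′)
+ℝ-cong x x′ y y′ x≈x′ y≈y′ = null-resp-≗
  (λ n → ≡.sym (+-difference (seq x n) (seq y n) (seq x′ n) (seq y′ n))) (null-+ x≈x′ y≈y′)

-- From xy - x′y′ = x(y - y′) + y′(x - x′): a Cauchy sequence is eventually bounded, and bounded
-- times null is null.
*ℝ-cong : ∀ x x′ y y′ → x ≈ℝ x′ → y ≈ℝ y′ → (x ℝᵣ.* y) ≈ℝ (x′ ℝᵣ.* y′)
*ℝ-cong x x′ y y′ x≈x′ y≈y′ = null-resp-≗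
  (λ n → ≡.sym (*-difference (seq x n) (seq y n) (seq x′ n) (seq y′ n)))
  (null-+ (null-* (cauchy-bounded {seq x} (cauchy x)) y≈y′)
          (null-* (cauchy-bounded {seq y′} (cauchy y′)) x≈x′))

-ℝ-cong : ∀ x y → x ≈ℝ y → (ℝᵣ.- x) ≈ℝ (ℝᵣ.- y)
-ℝ-cong x y x≈y =
  null-resp-≗ (λ n → ℚₚ.neg-distrib-+ (seq x n) (ℚ.- seq y n)) (null-neg x≈y)

ℝ-isCommutativeRing : HasCommutativeRingLaws ℝ-rawRing
ℝ-isCommutativeRing = record
  { isRing = record
    { +-isAbelianGroup = record
      { isGroup = record
        { isMonoid = record
          { isSemigroup = record
            { isMagma = record
              { isEquivalence = record
                { refl  = λ {x} → pointwise x x λ n → ≡.refl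
                ; sym   = λ {x} {y} → ≈ℝ-sym x y
                ; trans = λ {x} {y} {z} → ≈ℝ-trans x y z
                }
              ; ∙-cong = λ {x} {x′} {y} {y′} → +ℝ-cong x x′ y y′
              }
            ; assoc = λ x y z → pointwise ((x ℝᵣ.+ y) ℝᵣ.+ z) (x ℝᵣ.+ (y ℝᵣ.+ z)) λ n →
                ℚₚ.+-assoc (seq x n) (seq y n) (seq z n)
            }
          ; identity = (λ x → pointwise (ℝᵣ.0# ℝᵣ.+ x) x λ n → ℚₚ.+-identityˡ (seq x n))
                     , (λ x → pointwise (x ℝᵣ.+ ℝᵣ.0#) x λ n → ℚₚ.+-identityʳ (seq x n))
          }
        ; inverse = (λ x → pointwise (ℝᵣ.- x ℝᵣ.+ x) ℝᵣ.0# λ n → ℚₚ.+-inverseˡ (seq x n))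
                  , (λ x → pointwise (x ℝᵣ.+ ℝᵣ.- x) ℝᵣ.0# λ n → ℚₚ.+-inverseʳ (seq x n))
        ; ⁻¹-cong = λ {x} {y} → -ℝ-cong x y
        }
      ; comm = λ x y → pointwise (x ℝᵣ.+ y) (y ℝᵣ.+ x) λ n → ℚₚ.+-comm (seq x n) (seq y n)
      }
    ; *-cong     = λ {x} {x′} {y} {y′} → *ℝ-cong x x′ y y′
    ; *-assoc    = λ x y z → pointwise ((x ℝᵣ.* y) ℝᵣ.* z) (x ℝᵣ.* (y ℝᵣ.* z)) λ n →
        ℚₚ.*-assoc (seq x n) (seq y n) (seq z n)
    ; *-identity = (λ x → pointwise (ℝᵣ.1# ℝᵣ.* x) x λ n → ℚₚ.*-identityˡ (seq x n))
                 , (λ x → pointwise (x ℝᵣ.* ℝᵣ.1#) x λ n → ℚₚ.*-identityʳ (seq x n))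
    ; distrib    =
        (λ x y z → pointwise (x ℝᵣ.* (y ℝᵣ.+ z)) (x ℝᵣ.* y ℝᵣ.+ x ℝᵣ.* z) λ n →
          ℚₚ.*-distribˡ-+ (seq x n) (seq y n) (seq z n))
      , (λ x y z → pointwise ((y ℝᵣ.+ z) ℝᵣ.* x) (y ℝᵣ.* x ℝᵣ.+ z ℝᵣ.* x) λ n →
          ℚₚ.*-distribʳ-+ (seq x n) (seq y n) (seq z n))
    }
  ; *-comm = λ x y → pointwise (x ℝᵣ.* y) (y ℝᵣ.* x) λ n → ℚₚ.*-comm (seq x n) (seq y n)
  }

ℝ-commutativeRing : CommutativeRing 0ℓ 0ℓ
ℝ-commutativeRing = commutativeRing ℝ-rawRing ℝ-isCommutativeRing

recip-inverseˡ : ∀ x (x#0 : Apart₀ x) → (recip x x#0 ℝᵣ.* x) ≈ℝ ℝᵣ.1#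
recip-inverseˡ x (δ , 0<δ , N , apart) ε 0<ε = N , λ n N≤n →
  ≡.subst (λ q → ℚ.∣ q ℚ.- 1ℚ ∣ ℚ.≤ ε) (≡.sym (recipℚ-inverse 0<δ (apart n N≤n))) (ℚₚ.<⇒≤ 0<ε)

/-* : ∀ a k b l → (+ a ℚ./ suc k) ℚ.* (+ b ℚ./ suc l) ≡ + (a ℕ.* b) ℚ./ (suc k ℕ.* suc l)
/-* a k b l = ℚₚ.toℚᵘ-injective (begin
  ℚ.toℚᵘ ((+ a ℚ./ suc k) ℚ.* (+ b ℚ./ suc l))
    ≈⟨ ℚₚ.toℚᵘ-homo-* (+ a ℚ./ suc k) (+ b ℚ./ suc l) ⟩
  ℚ.toℚᵘ (+ a ℚ./ suc k) ℚᵘ.* ℚ.toℚᵘ (+ b ℚ./ suc l)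
    ≈⟨ ℚᵘₚ.*-cong (ℚₚ.toℚᵘ-fromℚᵘ (ℚᵘ.mkℚᵘ (+ a) k)) (ℚₚ.toℚᵘ-fromℚᵘ (ℚᵘ.mkℚᵘ (+ b) l)) ⟩
  ℚᵘ.mkℚᵘ (+ a) k ℚᵘ.* ℚᵘ.mkℚᵘ (+ b) l
    ≡⟨ ≡.cong (λ i → ℚᵘ.mkℚᵘ i (l ℕ.+ k ℕ.* suc l)) (ℤₚ.pos-* a b) ⟨
  ℚᵘ.mkℚᵘ (+ (a ℕ.* b)) (l ℕ.+ k ℕ.* suc l)
    ≈⟨ ℚₚ.toℚᵘ-fromℚᵘ (ℚᵘ.mkℚᵘ (+ (a ℕ.* b)) (l ℕ.+ k ℕ.* suc l)) ⟨
  ℚ.toℚᵘ (+ (a ℕ.* b) ℚ./ (suc k ℕ.* suc l)) ∎)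
  where open ℚᵘₚ.≃-Reasoning

/-+ : ∀ a b l → + (a ℕ.+ b) ℚ./ suc l ≡ + a ℚ./ suc l ℚ.+ + b ℚ./ suc l
/-+ zero    b l = ≡.sym (≡.trans (≡.cong (ℚ._+ + b ℚ./ suc l) (ℚₚ.0/n≡0 (suc l))) (ℚₚ.+-identityˡ _))
/-+ (suc a) b l = begin
  + suc (a ℕ.+ b) ℚ./ suc l                               ≡⟨ /-suc (a ℕ.+ b) l ⟩
  + 1 ℚ./ suc l ℚ.+ + (a ℕ.+ b) ℚ./ suc l                 ≡⟨ ≡.cong (+ 1 ℚ./ suc l ℚ.+_) (/-+ a b l) ⟩
  + 1 ℚ./ suc l ℚ.+ (+ a ℚ./ suc l ℚ.+ + b ℚ./ suc l)     ≡⟨ ℚₚ.+-assoc (+ 1 ℚ./ suc l) (+ a ℚ./ suc l) (+ b ℚ./ suc l) ⟨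
  (+ 1 ℚ./ suc l ℚ.+ + a ℚ./ suc l) ℚ.+ + b ℚ./ suc l     ≡⟨ ≡.cong (ℚ._+ + b ℚ./ suc l) (/-suc a l) ⟨
  + suc a ℚ./ suc l ℚ.+ + b ℚ./ suc l                     ∎
  where open ≡.≡-Reasoning

/-eventually-≤ : ∀ c ε → 0ℚ ℚ.< ε → ∃ λ N → ∀ n → N ℕ.≤ n → + c ℚ./ suc n ℚ.≤ ε
/-eventually-≤ c ε 0<ε with ε | ℚ.positive 0<ε
-- With ε = (p + 1)/(d + 1) the claim reads c(d + 1) ≤ (p + 1)(n + 1), which holds once n ≥ c(d +
-- 1).
... | mkℚ +[1+ p ] d coprime | _ = c ℕ.* suc d , λ n N≤n →
  ≡.subst (+ c ℚ./ suc n ℚ.≤_) (ℚₚ.fromℚᵘ-toℚᵘ (mkℚ +[1+ p ] d coprime))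
    (/-mono-≤ c n (suc p) d (ℕₚ.≤-trans (ℕₚ.m≤n⇒m≤1+n N≤n) (ℕₚ.m≤n*m (suc n) (suc p))))

√-square-≤ : ∀ m n → √-seq m n ℚ.* √-seq m n ℚ.≤ + m ℚ./ 1
√-square-≤ m n = ≡.subst (ℚ._≤ + m ℚ./ 1) (≡.sym (/-* a n a n))
  (/-mono-≤ (a ℕ.* a) _ m 0 (≡.subst (ℕ._≤ m ℕ.* (suc n ℕ.* suc n)) (≡.sym (ℕₚ.*-identityʳ (a ℕ.* a)))
    (proj₁ (isqrt-spec (m ℕ.* (suc n ℕ.* suc n))))))
  where a = √-numerator m n

-- Let K = n + 1 and let a be the integer part of K√m. Then mK² < (a + 1)² = a² + 2a + 1, and 2a + 1
-- ≤ (2m + 1)K because a ≤ mK. Division by K² leaves the error (2m + 1)/K.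
√-square-≥ : ∀ m n → + m ℚ./ 1 ℚ.≤ + suc (m ℕ.+ m) ℚ./ suc n ℚ.+ √-seq m n ℚ.* √-seq m n
√-square-≥ m n = begin
  + m ℚ./ 1
    ≤⟨ /-mono-≤ m 0 (e ℕ.* K ℕ.+ a ℕ.* a) _ (ℕₚ.≤-trans numerators (ℕₚ.≤-reflexive (≡.sym (ℕₚ.*-identityʳ _)))) ⟩
  + (e ℕ.* K ℕ.+ a ℕ.* a) ℚ./ (K ℕ.* K)
    ≡⟨ /-+ (e ℕ.* K) (a ℕ.* a) _ ⟩
  + (e ℕ.* K) ℚ./ (K ℕ.* K) ℚ.+ + (a ℕ.* a) ℚ./ (K ℕ.* K)
    ≡⟨ ≡.cong (+ (e ℕ.* K) ℚ./ (K ℕ.* K) ℚ.+_) (/-* a n a n) ⟨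
  + (e ℕ.* K) ℚ./ (K ℕ.* K) ℚ.+ √-seq m n ℚ.* √-seq m n
    ≤⟨ ℚₚ.+-monoˡ-≤ (√-seq m n ℚ.* √-seq m n)
         (/-mono-≤ (e ℕ.* K) _ e n (ℕₚ.≤-reflexive (ℕₚ.*-assoc e K K))) ⟩
  + e ℚ./ K ℚ.+ √-seq m n ℚ.* √-seq m n ∎
  where
  open ℚₚ.≤-Reasoning
  K = suc n
  a = √-numerator m n
  e = suc (m ℕ.+ m)
  -- The crude bound √m ≤ m suffices: a² ≤ mK² < (mK + 1)².
  a≤mK : a ℕ.≤ m ℕ.* K
  a≤mK = ℕ.s≤s⁻¹ (square-cancel-< (ℕₚ.≤-<-trans (proj₁ (isqrt-spec (m ℕ.* (K ℕ.* K)))) (bound m)))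
    where
    bound : ∀ m → m ℕ.* (K ℕ.* K) ℕ.< suc (m ℕ.* K) ℕ.* suc (m ℕ.* K)
    bound zero    = s≤s z≤n
    bound (suc m) = ℕₚ.≤-<-trans (ℕₚ.≤-trans (ℕₚ.≤-reflexive (≡.sym (ℕₚ.*-assoc (suc m) K K)))
      (ℕₚ.*-monoʳ-≤ (suc m ℕ.* K) (ℕₚ.m≤n*m K (suc m))))
      (ℕₚ.*-mono-< (ℕₚ.n<1+n (suc m ℕ.* K)) (ℕₚ.n<1+n (suc m ℕ.* K)))
  numerators : m ℕ.* (K ℕ.* K) ℕ.≤ e ℕ.* K ℕ.+ a ℕ.* a
  numerators = ℕₚ.≤-trans (ℕₚ.<⇒≤ (proj₂ (isqrt-spec (m ℕ.* (K ℕ.* K)))))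
    (ℕₚ.≤-trans (ℕₚ.≤-reflexive (expand a))
      (ℕₚ.+-monoˡ-≤ (a ℕ.* a) (ℕₚ.≤-trans
        (ℕₚ.+-mono-≤ (s≤s (z≤n {n})) (ℕₚ.+-mono-≤ a≤mK a≤mK))
        (ℕₚ.≤-reflexive (≡.sym (collect m K))))))
    where
    open ℕ-Solver
    expand : ∀ a → suc a ℕ.* suc a ≡ (1 ℕ.+ (a ℕ.+ a)) ℕ.+ a ℕ.* a
    expand = solve 1 (λ a → (con 1 :+ a) :* (con 1 :+ a) := (con 1 :+ (a :+ a)) :+ a :* a) ≡.refl
    collect : ∀ m K → suc (m ℕ.+ m) ℕ.* K ≡ K ℕ.+ (m ℕ.* K ℕ.+ m ℕ.* K)
    collect = solve 2 (λ m K → (con 1 :+ (m :+ m)) :* K := K :+ (m :* K :+ m :* K)) ≡.refl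

√-square : ∀ m → ((√ m) ℝᵣ.* (√ m)) ≈ℝ fromℚ (+ m ℚ./ 1)
√-square m ε 0<ε with N , small ← /-eventually-≤ (suc (m ℕ.+ m)) ε 0<ε = N , λ n N≤n → ∣-∣-bound
  (ℚₚ.≤-trans (√-square-≤ m n)
    (≡.subst (ℚ._≤ ε ℚ.+ + m ℚ./ 1) (ℚₚ.+-identityˡ (+ m ℚ./ 1))
      (ℚₚ.+-monoˡ-≤ (+ m ℚ./ 1) (ℚₚ.<⇒≤ 0<ε))))
  (ℚₚ.≤-trans (√-square-≥ m n) (ℚₚ.+-monoˡ-≤ (√-seq m n ℚ.* √-seq m n) (small n N≤n)))

module _ (R : CommutativeRing c ℓ) where
  open CommutativeRing R
  open SetoidReasoning setoid
  open SemiringSolver commutativeSemiring using (solve; _:*_; _:=_)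

  -- Inverses are unique: `r * r` and `b` are both inverse to `a`.
  inverse-square : ∀ {r s a b} → r * s ≈ 1# → s * s ≈ a → a * b ≈ 1# → r * r ≈ b
  inverse-square {r} {s} {a} {b} rs≈1 ss≈a ab≈1 = begin
    r * r                  ≈⟨ *-identityʳ _ ⟨
    r * r * 1#             ≈⟨ *-congˡ ab≈1 ⟨
    r * r * (a * b)        ≈⟨ *-congˡ (*-congʳ ss≈a) ⟨
    r * r * (s * s * b)    ≈⟨ solve 3 (λ r s b → r :* r :* (s :* s :* b) := (r :* s) :* (r :* s) :* b) refl r s b ⟩
    (r * s) * (r * s) * b  ≈⟨ *-congʳ (*-cong rs≈1 rs≈1) ⟩
    1# * 1# * b            ≈⟨ *-congʳ (*-identityˡ 1#) ⟩
    1# * b                 ≈⟨ *-identityˡ b ⟩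
    b                      ∎

1/√-square : ∀ m .{{_ : ℕ.NonZero m}} q → (+ m ℚ./ 1) ℚ.* q ≡ 1ℚ → ((1/√ m) ℝᵣ.* (1/√ m)) ≈ℝ fromℚ q
1/√-square m q mq≡1 = inverse-square ℝ-commutativeRing
  {1/√ m} {√ m} {fromℚ (+ m ℚ./ 1)} {fromℚ q}
  (recip-inverseˡ (√ m) (√-apart₀ m)) (√-square m)
  (pointwise (fromℚ (+ m ℚ./ 1) ℝᵣ.* fromℚ q) ℝᵣ.1# λ _ → mq≡1)

-- Degrees in the path

module _ {a p} {A : Set a} {P : Pred A p} (P? : Decidable P) where

  count-tabulate-none : (f : Fin n → A) → (∀ j → ¬ P (f j)) → count P? (tabulate f) ≡ 0
  count-tabulate-none {zero}  f ¬Pf = ≡.refl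
  count-tabulate-none {suc n} f ¬Pf with P? (f fzero)
  ... | yes Pf0 = contradiction Pf0 (¬Pf fzero)
  ... | no  _   = count-tabulate-none (f ∘ fsuc) (¬Pf ∘ fsuc)

  count-tabulate-unique : (f : Fin n → A) (k : Fin n) → P (f k) → (∀ j → P (f j) → j ≡ k) →
                          count P? (tabulate f) ≡ 1
  count-tabulate-unique f fzero Pfk unique with P? (f fzero)
  ... | yes _   = ≡.cong suc (count-tabulate-none (f ∘ fsuc) λ j Pfj → contradiction (unique (fsuc j) Pfj) λ ())
  ... | no  ¬Pf = contradiction Pfk ¬Pf
  count-tabulate-unique f (fsuc k) Pfk unique with P? (f fzero)
  ... | yes Pf0 = contradiction (unique fzero Pf0) λ ()
  ... | no  _   = count-tabulate-unique (f ∘ fsuc) k Pfk λ j → Fin.suc-injective ∘ unique (fsuc j)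

count-⊎ : ∀ {a p q} {A : Set a} {P : Pred A p} {Q : Pred A q} (P? : Decidable P) (Q? : Decidable Q) →
          (∀ x → P x → ¬ Q x) → (xs : Vec A n) →
          count (λ x → P? x ⊎-dec Q? x) xs ≡ count P? xs ℕ.+ count Q? xs
count-⊎ P? Q? disjoint []       = ≡.refl
count-⊎ P? Q? disjoint (x ∷ xs) with P? x | Q? x
... | yes Px | yes Qx = contradiction Qx (disjoint x Px)
... | yes _  | no  _  = ≡.cong suc (count-⊎ P? Q? disjoint xs)
... | no  _  | yes _  = ≡.trans (≡.cong suc (count-⊎ P? Q? disjoint xs)) (≡.sym (ℕₚ.+-suc _ _))
... | no  _  | no  _  = count-⊎ P? Q? disjoint xs

module _ (i : Fin n) where

  successors : ℕ
  successors = count (λ j → toℕ j ℕₚ.≟ suc (toℕ i)) (allFin n)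

  predecessors : ℕ
  predecessors = count (λ j → toℕ i ℕₚ.≟ suc (toℕ j)) (allFin n)

  -- A vertex cannot both follow and precede `i`, so the two kinds of neighbours can be counted
  -- separately; each count is 0 or 1.
  path-degree : Graph.degree (path n) i ≡ successors ℕ.+ predecessors
  path-degree = count-⊎ _ _ disjoint (allFin n)
    where
    disjoint : ∀ j → toℕ j ≡ suc (toℕ i) → ¬ (toℕ i ≡ suc (toℕ j))
    disjoint j j≡1+i i≡1+j = ℕₚ.<-asym (ℕₚ.≤-reflexive (≡.sym j≡1+i)) (ℕₚ.≤-reflexive (≡.sym i≡1+j))

  successors-one : suc (toℕ i) ℕ.< n → successors ≡ 1
  successors-one 1+i<n = count-tabulate-unique (λ j → toℕ j ℕₚ.≟ suc (toℕ i)) id (fromℕ< 1+i<n) (Fin.toℕ-fromℕ< 1+i<n)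
    λ j j≡1+i → Fin.toℕ-injective (≡.trans j≡1+i (≡.sym (Fin.toℕ-fromℕ< 1+i<n)))

  successors-none : suc (toℕ i) ≡ n → successors ≡ 0
  successors-none 1+i≡n = count-tabulate-none (λ j → toℕ j ℕₚ.≟ suc (toℕ i)) id λ j j≡1+i →
    ℕₚ.<-irrefl (≡.trans j≡1+i 1+i≡n) (Fin.toℕ<n j)

  predecessors-one : ∀ {k} → toℕ i ≡ suc k → predecessors ≡ 1
  predecessors-one {k} i≡1+k = count-tabulate-unique (λ j → toℕ i ℕₚ.≟ suc (toℕ j)) id (fromℕ< k<n)
    (≡.trans i≡1+k (≡.cong suc (≡.sym (Fin.toℕ-fromℕ< k<n))))
    λ j i≡1+j → Fin.toℕ-injective
      (≡.trans (ℕₚ.suc-injective (≡.trans (≡.sym i≡1+j) i≡1+k)) (≡.sym (Fin.toℕ-fromℕ< k<n)))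
    where
    k<n : k ℕ.< n
    k<n = ℕₚ.<-trans (ℕₚ.≤-reflexive (≡.sym i≡1+k)) (Fin.toℕ<n i)

  predecessors-none : toℕ i ≡ 0 → predecessors ≡ 0
  predecessors-none i≡0 = count-tabulate-none (λ j → toℕ i ℕₚ.≟ suc (toℕ j)) id λ (j : Fin n) i≡1+j → ℕₚ.0≢1+n (≡.trans (≡.sym i≡0) i≡1+j)

  degree-first : toℕ i ≡ 0 → 1 ℕ.< n → Graph.degree (path n) i ≡ 1
  degree-first i≡0 1<n = ≡.trans path-degree
    (≡.cong₂ ℕ._+_ (successors-one (≡.subst (λ k → suc k ℕ.< n) (≡.sym i≡0) 1<n)) (predecessors-none i≡0))

  degree-inner : ∀ {k} → toℕ i ≡ suc k → suc (suc k) ℕ.< n → Graph.degree (path n) i ≡ 2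
  degree-inner i≡1+k 2+k<n = ≡.trans path-degree
    (≡.cong₂ ℕ._+_ (successors-one (≡.subst (λ k → suc k ℕ.< n) (≡.sym i≡1+k) 2+k<n)) (predecessors-one i≡1+k))

  degree-last : ∀ {k} → toℕ i ≡ suc k → suc (suc k) ≡ n → Graph.degree (path n) i ≡ 1
  degree-last i≡1+k 2+k≡n = ≡.trans path-degree
    (≡.cong₂ ℕ._+_ (successors-none (≡.trans (≡.cong suc i≡1+k) 2+k≡n)) (predecessors-one i≡1+k))

-- The Randić matrix of the path

module _ (G : Graph n) where
  open Graph G
  open CommutativeRing ℝ-commutativeRing using () renaming (_*_ to _*ℝ_)

  -- These compare sequences rather than reals: comparing reals would make
  -- the type checker unfold the proofs of the Cauchy property.
  randić-seq-adjacent : ∀ {i j m} → Adj i j → degree i ℕ.* degree j ≡ m →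
                        ∀ k → seq (randićMatrix G i j) k ≡ recipℚ (√-seq m k)
  randić-seq-adjacent {i} {j} a d≡m k with adj? i j
  ... | yes _ = ≡.cong (λ m → recipℚ (√-seq m k)) d≡m
  ... | no ¬a = contradiction a ¬a

  randić-seq-nonAdjacent : ∀ {i j} → ¬ Adj i j → ∀ k → seq (randićMatrix G i j) k ≡ 0ℚ
  randić-seq-nonAdjacent {i} {j} ¬a k with adj? i j
  ... | yes a = contradiction a ¬a
  ... | no  _ = ≡.refl

  -- Both entries agree with `1/√ m` term by term, the second after commuting the product of
  -- degrees, so the product is a square and the root disappears.
  randić-product : ∀ {i j} m .{{_ : ℕ.NonZero m}} q → Adj i j → degree i ℕ.* degree j ≡ m →
                   (+ m ℚ./ 1) ℚ.* q ≡ 1ℚ → (randićMatrix G i j *ℝ randićMatrix G j i) ≈ℝ fromℚ q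
  randić-product {i} {j} m q a d≡m mq≡1 = ≈ℝ-trans (x *ℝ y) (r *ℝ r) (fromℚ q)
    (*ℝ-cong x r y r
      (pointwise x r (randić-seq-adjacent {i} {j} a d≡m))
      (pointwise y r (randić-seq-adjacent {j} {i} (symm a)
        (≡.trans (ℕₚ.*-comm (degree j) (degree i)) d≡m))))
    (1/√-square m q mq≡1)
    where
    x = randićMatrix G i j
    y = randićMatrix G j i
    r = 1/√ m

-- In the path on m + 3 vertices, the edges 0 and m + 1 contain an end vertex.
pathWeight : ℕ → ℕ → ℚ
pathWeight m zero    = ½
pathWeight m (suc i) = if does (i ℕₚ.≟ m) then ½ else + 1 ℚ./ 4

pathWeight-last : ∀ m → pathWeight m (suc m) ≡ ½
pathWeight-last m = ≡.cong (if_then ½ else (+ 1 ℚ./ 4)) (dec-true (m ℕₚ.≟ m) ≡.refl)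

pathWeight-inner : ∀ {m i} → i ≢ m → pathWeight m (suc i) ≡ + 1 ℚ./ 4
pathWeight-inner {m} {i} i≢m = ≡.cong (if_then ½ else (+ 1 ℚ./ 4)) (dec-false (i ℕₚ.≟ m) i≢m)

-- The degree product is 1 · 2 at an end edge and 2 · 2 elsewhere. Writing it as `suc d` shows that
-- it is nonzero, and the index `v` is kept apart from `toℕ i` so that it can be matched on.
pathWeight-degrees : ∀ m {i j : Fin (suc (suc (suc m)))} v → toℕ i ≡ v → toℕ j ≡ suc v →
  let open Graph (path (suc (suc (suc m)))) in
  ∃ λ d → degree i ℕ.* degree j ≡ suc d × (+ suc d ℚ./ 1) ℚ.* pathWeight m v ≡ 1ℚ
pathWeight-degrees m {i} {j} zero i≡0 j≡1 = 1 , ≡.cong₂ ℕ._*_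
  (degree-first i i≡0 (s≤s (s≤s z≤n))) (degree-inner j j≡1 (s≤s (s≤s (s≤s z≤n)))) , ≡.refl
-- The vertex `j` has index k + 2, so among m + 3 vertices it is the last one exactly when k = m.
pathWeight-degrees m {i} {j} (suc k) i≡1+k j≡2+k with k ℕₚ.≟ m
... | yes ≡.refl = 1 , ≡.cong₂ ℕ._*_
  (degree-inner i i≡1+k ℕₚ.≤-refl) (degree-last j j≡2+k ≡.refl) ,
  ≡.cong ((+ 2 ℚ./ 1) ℚ.*_) (pathWeight-last m)
... | no  k≢m    = 3 , ≡.cong₂ ℕ._*_
  (degree-inner i i≡1+k (ℕₚ.<-trans (ℕₚ.n<1+n _) 3+k<3+m)) (degree-inner j j≡2+k 3+k<3+m) ,
  ≡.cong ((+ 4 ℚ./ 1) ℚ.*_) (pathWeight-inner k≢m)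
  where
  3+k≤3+m : 3 ℕ.+ k ℕ.≤ 3 ℕ.+ m
  3+k≤3+m = ≡.subst (ℕ._< 3 ℕ.+ m) j≡2+k (Fin.toℕ<n j)
  3+k<3+m : 3 ℕ.+ k ℕ.< 3 ℕ.+ m
  3+k<3+m = ℕₚ.≤∧≢⇒< 3+k≤3+m (k≢m ∘ ℕₚ.+-cancelˡ-≡ 3 k m)

open TridiagonalDeterminant ℝ-commutativeRing using (IsTridiagonal)

randić-path-isTridiagonal : ∀ n → 3 ≤ n →
  IsTridiagonal (fromℚ 0ℚ) (fromℚ ∘ pathWeight (n ∸ 3)) (randićMatrix (path n))
randić-path-isTridiagonal (suc (suc (suc m))) (s≤s (s≤s (s≤s z≤n))) = record
  { diagonal = λ i → zero-entry (irrefl {i} ≡.refl)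
  ; upper    = λ i j 2+i≤j → zero-entry (far 2+i≤j)
  ; lower    = λ i j 2+j≤i → zero-entry (far 2+j≤i ∘ symm {i} {j})
  ; product  = λ i j j≡1+i →
      let d , degrees , weight = pathWeight-degrees m (toℕ i) ≡.refl j≡1+i
      in  randić-product (path N) {i} {j} (suc d) (pathWeight m (toℕ i)) (inj₁ j≡1+i) degrees weight
  }
  where
  N = suc (suc (suc m))
  open Graph (path N)
  zero-entry : ∀ {i j} → ¬ Adj i j → randićMatrix (path N) i j ≈ℝ fromℚ 0ℚ
  zero-entry {i} {j} ¬a = pointwise (randićMatrix (path N) i j) (fromℚ 0ℚ)
    (randić-seq-nonAdjacent (path N) {i} {j} ¬a)
  far : ∀ {i j : Fin N} → suc (suc (toℕ i)) ≤ toℕ j → ¬ Adj i j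
  far 2+i≤j (inj₁ j≡1+i) = ℕₚ.<-irrefl (≡.sym j≡1+i) 2+i≤j
  far 2+i≤j (inj₂ i≡1+j) = ℕₚ.<-asym (ℕₚ.≤-reflexive (≡.sym i≡1+j)) (ℕₚ.<-trans (ℕₚ.n<1+n _) 2+i≤j)

open import Defs using (_≈_; _*_; 1#; _-_)

theorem1 : (n : ℕ) → 5 ≤ n → RP (path n) ≈ (λ̂ * λ̂ - 1#) * (λ̂ * Λ (n ∸ 3) - ¼ * Λ (n ∸ 4))
theorem1 n 5≤n =
  characteristicPolynomial-path {fromℚ (+ 1 ℚ./ 4)} {fromℚ ½} (fromℚ ∘ pathWeight (n ∸ 3))
    (pointwise (fromℚ ½ ℝᵣ.+ fromℚ ½) (fromℚ 1ℚ) λ _ → ≡.refl)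
    (pointwise (fromℚ ½ ℝᵣ.* fromℚ ½) (fromℚ (+ 1 ℚ./ 4)) λ _ → ≡.refl)
    -- `Λ` satisfies these equations by definition, with its filler value at 0 as the required 1.
    Λ (≈-refl 1#) (≈-refl λ̂) (≈-refl (Λ 2)) (λ j → ≈-refl (Λ (3 ℕ.+ j)))
    n (ℕₚ.≤-trans (ℕₚ.n≤1+n 4) 5≤n) {randićMatrix (path n)}
    (randić-path-isTridiagonal n (ℕₚ.≤-trans (ℕₚ.m≤n+m 3 2) 5≤n))
    (pointwise (fromℚ ½) (fromℚ ½) λ _ → ≡.refl)
    (λ i i<n∸3 → pointwise (fromℚ (pathWeight (n ∸ 3) (suc i))) (fromℚ (+ 1 ℚ./ 4)) λ _ →
      pathWeight-inner (ℕₚ.<⇒≢ i<n∸3))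
    (pointwise (fromℚ (pathWeight (n ∸ 3) (suc (n ∸ 3)))) (fromℚ ½) λ _ → pathWeight-last (n ∸ 3))
  where
  open CharacteristicPolynomial ℝ-rawRing ℝ-isCommutativeRing using (characteristicPolynomial-path)
  ≈-refl : ∀ p → p ≈ p
  ≈-refl p k = pointwise (Polynomial.coeff ℝ-rawRing p k) (Polynomial.coeff ℝ-rawRing p k) λ _ → ≡.refl
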